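{- There exists a one-dimensional persistent cellular automaton $\mathcal{U}$ such that $\mathcal{A}\preccurlyeq\mathcal{U}$ for every one-dimensional persistent cellular automaton $\mathcal{A}$.
   Context: A one-dimensional cellular automaton (CA) over a finite alphabet $Q$ is a map $F:Q^{\mathbb{Z}}\to Q^{\mathbb{Z}}$, $F(c)(z)=f(c(z+v_1),\dots,c(z+v_k))$ for a finite neighborhood $\{v_1,\dots,v_k\}\subseteq\mathbb{Z}$ and local rule $f$; $\sigma_z(c)(z')=c(z'+z)$, and $Q^{\mathbb{Z}}$ has the product topology. A CA $F$ is persistent if there is a state $q_0\in Q$ such that for every configuration $c$ and every $i\in\mathbb{Z}$, $c(i)=q_0$ implies $F(c)(i)=q_0$. The canonical action of a CA $F$ is the $\mathbb{N}\times\mathbb{Z}$-action $((t,z),x)\mapsto\sigma_z\circ F^t(x)$; a scaled action is its restriction to a submonoid $t_0\mathbb{N}\times z_1\mathbb{Z}$ with $t_0,z_1>0$, two such submonoids being identified by the canonical isomorphism $(t_0a,z_1b)\mapsto(t_0'a,z_1'b)$. An action $\phi'$ on $X'$ is a factor of an action $\phi$ on $X$ if there is a continuous onto $\pi:X\to X'$ with $\pi(\phi(m,x))=\phi'(i(m),\pi(x))$ for all $m,x$. For CA $S,T$, $T\preccurlyeq S$ means some scaled action of $S$ factors onto some scaled action of $T$. -}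

module Defs where

open import Data.Nat using (ℕ; zero; suc; _*_; _≤_; _>_)
open import Data.Integer as ℤ using (ℤ; +_; ∣_∣)
open import Data.Fin using (Fin)
open import Data.Vec using (Vec; map)
open import Data.Product using (Σ; ∃; ∃-syntax; _×_; _,_)
open import Relation.Binary.PropositionalEquality using (_≡_)

Config : ℕ → Set
Config n = ℤ → Fin n

_≈_ : ∀ {n} → Config n → Config n → Set
c ≈ d = ∀ i → c i ≡ d i

σ : ∀ {n} → ℤ → Config n → Config n
σ z c z' = c (z' ℤ.+ z)

record CA : Set where
  field
    states : ℕ
    k      : ℕ
    nbhd   : Vec ℤ k
    rule   : Vec (Fin states) k → Fin states

open CA public

global : (A : CA) → Config (states A) → Config (states A)
global A c z = rule A (map (λ v → c (z ℤ.+ v)) (nbhd A))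

iter : (A : CA) → ℕ → Config (states A) → Config (states A)
iter A zero    c = c
iter A (suc t) c = global A (iter A t c)

Persistent : CA → Set
Persistent A = ∃[ q₀ ] ∀ (c : Config (states A)) (i : ℤ) → c i ≡ q₀ → global A c i ≡ q₀

-- Continuity for the product topology on Fin m ^ ℤ → Fin n ^ ℤ.
Continuous : ∀ {m n} → (Config m → Config n) → Set
Continuous π = ∀ x (r : ℕ) → ∃[ s ] ∀ y →
  (∀ i → ∣ i ∣ ≤ s → x i ≡ y i) → ∀ j → ∣ j ∣ ≤ r → π x j ≡ π y j

Onto : ∀ {m n} → (Config m → Config n) → Set
Onto π = ∀ y → ∃[ x ] π x ≈ y

-- Scaled action of A on t₀ℕ × z₁ℤ, evaluated at the generator coordinates (a,b):
-- (t₀ a, z₁ b) ↦ σ_{z₁ b} ∘ F^{t₀ a}.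
scaled : (A : CA) → ℕ → ℕ → ℕ → ℤ → Config (states A) → Config (states A)
scaled A t₀ z₁ a b x = σ ((+ z₁) ℤ.* b) (iter A (t₀ * a) x)

-- T ≼ S : some scaled action of S factors onto some scaled action of T
-- (submonoids identified by the canonical isomorphism).
_≼_ : CA → CA → Set
T ≼ S = ∃[ t₀ ] ∃[ z₁ ] ∃[ t₀' ] ∃[ z₁' ]
  (t₀ > 0 × z₁ > 0 × t₀' > 0 × z₁' > 0 ×
   Σ (Config (states S) → Config (states T)) λ π →
     Continuous π × Onto π ×
     (∀ (a : ℕ) (b : ℤ) x →
        π (scaled S t₀ z₁ a b x) ≈ scaled T t₀' z₁' a b (π x)))

{-# OPTIONS --safe #-}
module Submission where

-- A block of U consists of a marker cell, h further cells and the marker of the next block.  The h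
-- cells hold a cyclic program on two opposite lanes (of period h), and between the markers a token
-- "ping" and a token "pong" run back and forth on two further lanes (with period 2w, w = h + 1).
-- Whenever the ping comes home, its marker executes the operation that arrives at the same time.  As
-- 2w ≡ 2 (mod h), it meets every second operation in turn, and after h w steps everything but
-- the data held by markers and pings is back in its initial position.  The ping also carries messages
-- between neighbouring markers.
--
-- The difficulty is that every configuration of U has to be decoded, hence that the neighbour of a
-- block may be something which only imitates a block.  A marker compares the streams that it receives
-- from its two sides.  If they agree for long enough, then the ping (or pong) sent to the other side
-- came back after exactly 2w steps.  Either there is a marker at distance w, or an identical
-- token came from further away; but then the two have met, and a cell where this happens dies, for ever
-- (this is the persistent state of U), and blocks the way.  So imitations are recognized, they never
-- become blocks, and blocks treat them as invisible neighbours.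
--
-- The blocks thus form an array of small register machines that execute a common program in
-- parallel.  Such a program can compute any function of a window of one-bit registers by table lookup.
-- A group of n = |Q|^r blocks with a mark on the first one encodes, one-hot, r consecutive cells of the
-- simulated automaton, where r exceeds its radius.  A defective group stands for r cells in the
-- persistent state q₀: defects stay, and so do these states.

open import Defs
open import Data.Bool.Base using (Bool; true; false; if_then_else_; _∧_; not)
open import Data.Bool.Properties using (∧-assoc; ∧-identityʳ) renaming (_≟_ to _≟ᵇ_)
open import Data.Empty using (⊥-elim)
open import Data.Fin.Base using (Fin; zero; suc; toℕ; fromℕ<; combine; remQuot; funToFin; finToFun; join; splitAt)
open import Data.Fin.Properties as Finₚ using (toℕ<n; toℕ-fromℕ<; fromℕ<-toℕ; remQuot-combine; finToFun-funToFin; splitAt-join)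
open import Data.Integer.Base as ℤ using (ℤ; +_; -[1+_]; ∣_∣)
import Data.Integer.Properties as ℤₚ
import Data.Integer.DivMod as ℤᵈ
import Data.Integer.Tactic.RingSolver as ℤˢ
open import Data.List.Base using (List; []; _∷_; _++_; replicate; length; cartesianProductWith)
open import Data.List.Membership.Propositional using (_∈_)
open import Data.List.Membership.Propositional.Properties using (∈-cartesianProductWith⁺)
open import Data.List.Relation.Unary.All using (All; []; _∷_)
import Data.List.Relation.Unary.All.Properties as Allₚ
open import Data.List.Relation.Unary.Any using (here; there)
open import Data.Maybe.Base as Maybe using (Maybe; just; nothing; _>>=_)
import Data.Maybe.Properties as Maybeₚ
open import Data.Nat.Base using (ℕ; zero; suc; _+_; _*_; _∸_; _≤_; _<_; z≤n; s≤s; z<s; NonZero; _⊔_; _^_; _>_; >-nonZero)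
open import Data.Nat.DivMod using (_%_; _/_; m%n<n; m≡m%n+[m/n]*n; [m+kn]%n≡m%n; [m+n]%n≡m%n; m<n⇒m%n≡m; m*n%n≡0; m*n/n≡m; %-distribˡ-+; n%n≡0)
open import Data.Nat.Properties renaming (_≟_ to _≟ⁿ_)
open import Data.Nat.Tactic.RingSolver using (solve-∀)
open import Data.Product using (Σ; ∃; _×_; _,_; proj₁; proj₂)
open import Data.Sum.Base using (_⊎_; inj₁; inj₂)
open import Data.Vec.Base as Vec using (Vec; []; _∷_)
import Data.Vec.Properties as Vecₚ
open import Function.Base using (_∘_; id; case_of_)
open import Relation.Binary.Definitions using (DecidableEquality; tri<; tri≈; tri>)
open import Relation.Binary.PropositionalEquality
open import Relation.Nullary using (¬_; Dec; yes; no; does; contradiction)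
open import Relation.Nullary.Decidable using (map′; _×-dec_; dec-true; dec-false)

-- Finite alphabets

record Finite (S : Set) : Set where
  field
    size    : ℕ
    to      : S → Fin size
    from    : Fin size → S
    from-to : ∀ s → from (to s) ≡ s

  decEq : DecidableEquality S
  decEq a b = map′ (λ e → trans (sym (from-to a)) (trans (cong from e) (from-to b)))
               (cong to) (to a Finₚ.≟ to b)

open Finite using (size; to; from; from-to)

fin-finite : ∀ n → Finite (Fin n)
fin-finite n = record { size = n ; to = id ; from = id ; from-to = λ _ → refl }

retract-finite : ∀ {S S′ : Set} → Finite S′ →
  (f : S → S′) (g : S′ → S) → (∀ s → g (f s) ≡ s) → Finite S
retract-finite F f g gf = record
  { size = size F ; to = to F ∘ f ; from = g ∘ from F
  ; from-to = λ s → trans (cong g (from-to F (f s))) (gf s) }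

infixr 3 _×-finite_
_×-finite_ : ∀ {S S′ : Set} → Finite S → Finite S′ → Finite (S × S′)
_×-finite_ {S} {S′} F G = record { size = size F * size G ; to = enc ; from = dec ; from-to = dec-enc }
  where
  enc : S × S′ → Fin (size F * size G)
  enc (a , b) = combine (to F a) (to G b)
  post : Fin (size F) × Fin (size G) → S × S′
  post (i , j) = from F i , from G j
  dec : Fin (size F * size G) → S × S′
  dec k = post (remQuot (size G) k)
  dec-enc : ∀ p → dec (enc p) ≡ p
  dec-enc (a , b) = trans (cong post (remQuot-combine (to F a) (to G b))) (cong₂ _,_ (from-to F a) (from-to G b))

infixr 2 _⊎-finite_
_⊎-finite_ : ∀ {S S′ : Set} → Finite S → Finite S′ → Finite (S ⊎ S′)
_⊎-finite_ {S} {S′} F G = record { size = size F + size G ; to = enc ; from = dec ; from-to = dec-enc }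
  where
  pre : S ⊎ S′ → Fin (size F) ⊎ Fin (size G)
  pre (inj₁ a) = inj₁ (to F a)
  pre (inj₂ b) = inj₂ (to G b)
  post : Fin (size F) ⊎ Fin (size G) → S ⊎ S′
  post (inj₁ a) = inj₁ (from F a)
  post (inj₂ b) = inj₂ (from G b)
  enc : S ⊎ S′ → Fin (size F + size G)
  enc s = join (size F) (size G) (pre s)
  dec : Fin (size F + size G) → S ⊎ S′
  dec k = post (splitAt (size F) k)
  dec-enc : ∀ s → dec (enc s) ≡ s
  dec-enc (inj₁ a) = trans (cong post (splitAt-join (size F) (size G) (inj₁ (to F a)))) (cong inj₁ (from-to F a))
  dec-enc (inj₂ b) = trans (cong post (splitAt-join (size F) (size G) (inj₂ (to G b)))) (cong inj₂ (from-to G b))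

bool-finite : Finite Bool
bool-finite = retract-finite (fin-finite 2) (λ { false → zero ; true → suc zero })
  (λ { zero → false ; (suc zero) → true }) (λ { false → refl ; true → refl })

Symbol : Set
Symbol = Bool × Bool

Message : Set
Message = Maybe Symbol

message-finite : Finite Message
message-finite = retract-finite (fin-finite 1 ⊎-finite bool-finite ×-finite bool-finite)
  (λ { nothing → inj₁ zero ; (just b) → inj₂ b }) (λ { (inj₁ _) → nothing ; (inj₂ b) → just b })
  (λ { nothing → refl ; (just _) → refl })

-- `test` and `put` realize one line of a lookup table: after `arm`, `put b` takes effect only
-- if all tests in between have succeeded; `commit` then makes the new bit visible.
data Op : Set where
  init nop reset fromRight fromLeft arm commit : Op
  test : Message → Op
  put : Bool → Op

op-finite : Finite Op
op-finite = retract-finite (fin-finite 7 ⊎-finite message-finite ⊎-finite bool-finite) enc dec dec-enc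
  where
  enc : Op → Fin 7 ⊎ Message ⊎ Bool
  enc init      = inj₁ zero
  enc nop       = inj₁ (suc zero)
  enc reset     = inj₁ (suc (suc zero))
  enc fromRight = inj₁ (suc (suc (suc zero)))
  enc fromLeft  = inj₁ (suc (suc (suc (suc zero))))
  enc arm       = inj₁ (suc (suc (suc (suc (suc zero)))))
  enc commit    = inj₁ (suc (suc (suc (suc (suc (suc zero))))))
  enc (test p)  = inj₂ (inj₁ p)
  enc (put b)   = inj₂ (inj₂ b)
  dec : Fin 7 ⊎ Message ⊎ Bool → Op
  dec (inj₁ zero)                                     = init
  dec (inj₁ (suc zero))                               = nop
  dec (inj₁ (suc (suc zero)))                         = reset
  dec (inj₁ (suc (suc (suc zero))))                   = fromRight
  dec (inj₁ (suc (suc (suc (suc zero)))))             = fromLeft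
  dec (inj₁ (suc (suc (suc (suc (suc zero))))))       = arm
  dec (inj₁ (suc (suc (suc (suc (suc (suc zero))))))) = commit
  dec (inj₂ (inj₁ p))                                 = test p
  dec (inj₂ (inj₂ b))                                 = put b
  dec-enc : ∀ o → dec (enc o) ≡ o
  dec-enc init      = refl
  dec-enc nop       = refl
  dec-enc reset     = refl
  dec-enc fromRight = refl
  dec-enc fromLeft  = refl
  dec-enc arm       = refl
  dec-enc commit    = refl
  dec-enc (test p)  = refl
  dec-enc (put b)   = refl

-- The decision procedures and `cell-finite` are abstract so that the type checker does not unfold the encodings.
abstract
  _≟ᵐ_ : DecidableEquality Message
  _≟ᵐ_ = Finite.decEq message-finite

abstract
  _≟ᵒ_ : DecidableEquality Op
  _≟ᵒ_ = Finite.decEq op-finite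

record Reg : Set where
  constructor ⟨_,_,_,_,_⟩
  field
    mark bit armed new : Bool
    msg : Message

open Reg

reg-finite : Finite Reg
reg-finite = retract-finite
  (bool-finite ×-finite bool-finite ×-finite bool-finite ×-finite bool-finite ×-finite message-finite)
  (λ { ⟨ a , b , c , d , e ⟩ → a , b , c , d , e }) (λ { (a , b , c , d , e) → ⟨ a , b , c , d , e ⟩ })
  (λ _ → refl)

-- exec o l s r: l and r are the messages of the left and right neighbours (`nothing` for invalid ones).
exec : Op → Message → Reg → Message → Reg
exec init      l s r = s
exec nop       l s r = s
exec reset     l s r = record s { msg = just (mark s , bit s) }
exec fromRight l s r = record s { msg = r }
exec fromLeft  l s r = record s { msg = l }
exec arm       l s r = record s { armed = true }
exec (test p)  l s r = record s { armed = armed s ∧ does (msg s ≟ᵐ p) }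
exec (put b)   l s r = record s { new = if armed s then b else new s }
exec commit    l s r = record s { bit = new s }

data Token : Set where
  empty pong : Token
  ping : Message → Token

token-finite : Finite Token
token-finite = retract-finite (bool-finite ⊎-finite message-finite)
  (λ { empty → inj₁ false ; pong → inj₁ true ; (ping m) → inj₂ m })
  (λ { (inj₁ false) → empty ; (inj₁ true) → pong ; (inj₂ m) → ping m })
  (λ { empty → refl ; pong → refl ; (ping _) → refl })

-- What remains of a token without its payload: ● for ping, ○ for pong.
data Kind : Set where
  ∅ ● ○ : Kind

kind-finite : Finite Kind
kind-finite = retract-finite (fin-finite 3)
  (λ { ∅ → zero ; ● → suc zero ; ○ → suc (suc zero) })
  (λ { zero → ∅ ; (suc zero) → ● ; (suc (suc zero)) → ○ })
  (λ { ∅ → refl ; ● → refl ; ○ → refl })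

abstract
  _≟ᵏ_ : DecidableEquality Kind
  _≟ᵏ_ = Finite.decEq kind-finite

kind : Token → Kind
kind empty    = ∅
kind (ping _) = ●
kind pong     = ○

swap : Kind → Kind
swap ∅ = ∅
swap ● = ○
swap ○ = ●

clash : Kind → Kind → Bool
clash ● ● = true
clash ○ ○ = true
clash _ _ = false

-- `mid` is a cell inside a block, `mk` a marker.  `bad` records that the streams from the left and from
-- the right have differed since the last `init`; `inbox` is the last message from the left.
data Cell : Set where
  dead : Cell
  mid  : (toRight toLeft : Token) (opRight opLeft : Op) → Cell
  mk   : (toRight toLeft : Token) (bad : Bool) (inbox : Message) (regs : Reg) → Cell

abstract

  cell-finite : Finite Cell
  cell-finite = retract-finite
    (fin-finite 1
      ⊎-finite (token-finite ×-finite token-finite ×-finite op-finite ×-finite op-finite)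
      ⊎-finite (token-finite ×-finite token-finite ×-finite bool-finite ×-finite message-finite ×-finite reg-finite))
    (λ { dead → inj₁ zero ; (mid a b c d) → inj₂ (inj₁ (a , b , c , d))
       ; (mk a b c d e) → inj₂ (inj₂ (a , b , c , d , e)) })
    (λ { (inj₁ _) → dead ; (inj₂ (inj₁ (a , b , c , d))) → mid a b c d
       ; (inj₂ (inj₂ (a , b , c , d , e))) → mk a b c d e })
    (λ { dead → refl ; (mid _ _ _ _) → refl ; (mk _ _ _ _ _) → refl })

-- The local rule of U

-- The part of a cell that evolves independently of messages and registers.
data Shape : Set where
  dead : Shape
  mid  : (toRight toLeft : Kind) (opRight opLeft : Op) → Shape
  mk   : (toRight toLeft : Kind) → Shape

shape : Cell → Shape
shape dead          = dead
shape (mid a b c d) = mid (kind a) (kind b) c d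
shape (mk a b _ _ _) = mk (kind a) (kind b)

data Type : Set where
  dead mid mk : Type

type : Shape → Type
type dead          = dead
type (mid _ _ _ _) = mid
type (mk _ _)      = mk

outK inK : Shape → Kind
outK dead          = ∅
outK (mid o i _ _) = o
outK (mk o i)      = o
inK dead          = ∅
inK (mid o i _ _) = i
inK (mk o i)      = i

outO inO : Shape → Op
outO (mid _ _ o i) = o
outO _             = nop
inO (mid _ _ o i) = i
inO _             = nop

-- Operations turn around at the last cell before a marker.
nextOut nextIn : Shape → Op → Op
nextOut (mid _ _ o _) own = o
nextOut _             own = own
nextIn (mid _ _ _ i) own = i
nextIn _             own = own

arriveOut arriveIn : Shape → Kind
arriveOut (mid o _ _ _) = o
arriveOut _             = ∅
arriveIn (mid _ i _ _) = i
arriveIn _             = ∅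

alive : Shape → Bool
alive dead = false
alive _    = true

-- A marker reflects the tokens of its two sides separately, so that adjacent blocks do not
-- influence each other's shapes. Death spreads over intermediate cells and stops at markers.
stepShape : Shape → Shape → Shape → Shape
stepShape l dead r = dead
stepShape l (mk _ _) r = mk (arriveIn r) (arriveOut l)
stepShape l (mid _ _ o i) r =
  if alive l ∧ alive r ∧ not (clash (outK l) (inK r))
  then mid (outK l) (inK r) (nextOut l i) (nextIn r o)
  else dead

-- The tokens that two adjacent genuine blocks bring to their common marker differ by half a period,
-- which is what `swap` expresses.
match : Shape → Shape → Bool
match (mid o _ p _) (mid _ i _ q) = does (o ≟ᵏ swap i) ∧ does (p ≟ᵒ q)
match _             _             = false

tokRight tokLeft : Cell → Token
tokRight dead           = empty
tokRight (mid a b c d)  = a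
tokRight (mk a b _ _ _) = a
tokLeft dead           = empty
tokLeft (mid a b c d)  = b
tokLeft (mk a b _ _ _) = b

arriveRight arriveLeft : Cell → Token
arriveRight (mid a _ _ _) = a
arriveRight _             = empty
arriveLeft (mid _ b _ _) = b
arriveLeft _             = empty

arriveOp : Cell → Op
arriveOp (mid _ _ _ o) = o
arriveOp _             = nop

isPing : Kind → Bool
isPing ● = true
isPing _ = false

isInit : Op → Bool
isInit init = true
isInit _    = false

execOn : Token → Op → Message → Reg → Reg
execOn (ping r) o l s = exec o l s r
execOn _        o l s = s

emit : Token → Message → Token
emit (ping _) m = ping m
emit t        m = t

receive : Token → Message → Message
receive (ping m) _ = m
receive _        m = m

mask : Bool → Message → Message
mask bad m = if bad then nothing else m

-- A mismatch takes precedence over `init`, so that the program of an imitation cannot clear the flag.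
newBad : Bool → Kind → Op → Bool → Bool
newBad matched k o b = if matched then not (isPing k ∧ isInit o) ∧ b else true

-- A marker executes operations for the block on its right only. To the ping of the left block it
-- just replies, and the reply is suppressed when the two streams have disagreed.
step : Cell → Cell → Cell → Cell
step l dead r = dead
step l (mid _ _ o i) r =
  if alive (shape l) ∧ alive (shape r) ∧ not (clash (outK (shape l)) (inK (shape r)))
  then mid (tokRight l) (tokLeft r) (nextOut (shape l) i) (nextIn (shape r) o)
  else dead
step l (mk _ _ bad inbox s) r = mk
  (emit (arriveLeft r) (msg s′))
  (emit (arriveRight l) (mask bad (msg s)))
  (newBad (match (shape l) (shape r)) (kind (arriveLeft r)) (arriveOp r) bad)
  (receive (arriveRight l) inbox)
  s′
  where s′ = execOn (arriveLeft r) (arriveOp r) (mask bad inbox) s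

kind-emit : ∀ t m → kind (emit t m) ≡ kind t
kind-emit empty    m = refl
kind-emit pong     m = refl
kind-emit (ping _) m = refl

kind-tokRight : ∀ c → kind (tokRight c) ≡ outK (shape c)
kind-tokRight dead           = refl
kind-tokRight (mid _ _ _ _)  = refl
kind-tokRight (mk _ _ _ _ _) = refl

kind-tokLeft : ∀ c → kind (tokLeft c) ≡ inK (shape c)
kind-tokLeft dead           = refl
kind-tokLeft (mid _ _ _ _)  = refl
kind-tokLeft (mk _ _ _ _ _) = refl

kind-arriveRight : ∀ c → kind (arriveRight c) ≡ arriveOut (shape c)
kind-arriveRight dead           = refl
kind-arriveRight (mid _ _ _ _)  = refl
kind-arriveRight (mk _ _ _ _ _) = refl

kind-arriveLeft : ∀ c → kind (arriveLeft c) ≡ arriveIn (shape c)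
kind-arriveLeft dead           = refl
kind-arriveLeft (mid _ _ _ _)  = refl
kind-arriveLeft (mk _ _ _ _ _) = refl

shape-step : ∀ l c r → shape (step l c r) ≡ stepShape (shape l) (shape c) (shape r)
shape-step l dead r = refl
shape-step l (mk _ _ _ _ s) r = cong₂ mk
  (trans (kind-emit (arriveLeft r) _) (kind-arriveLeft r))
  (trans (kind-emit (arriveRight l) _) (kind-arriveRight l))
shape-step l (mid _ _ o i) r
  with alive (shape l) ∧ alive (shape r) ∧ not (clash (outK (shape l)) (inK (shape r)))
... | true  = cong₂ (λ a b → mid a b (nextOut (shape l) i) (nextIn (shape r) o)) (kind-tokRight l) (kind-tokLeft r)
... | false = refl

-- Symmetry and inversion of the shape rule

mirror : Shape → Shape
mirror dead          = dead
mirror (mid a b c d) = mid b a d c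
mirror (mk a b)      = mk b a

clash-comm : ∀ a b → clash a b ≡ clash b a
clash-comm ∅ ∅ = refl
clash-comm ∅ ● = refl
clash-comm ∅ ○ = refl
clash-comm ● ∅ = refl
clash-comm ● ● = refl
clash-comm ● ○ = refl
clash-comm ○ ∅ = refl
clash-comm ○ ● = refl
clash-comm ○ ○ = refl

-- Messages and registers break the left-right symmetry, but shapes do not. This allows one analysis
-- of a half line to serve for both sides of a marker.
mirror-step : ∀ l c r → mirror (stepShape l c r) ≡ stepShape (mirror r) (mirror c) (mirror l)
mirror-step l dead r = refl
mirror-step dead          (mk _ _) dead          = refl
mirror-step dead          (mk _ _) (mid _ _ _ _) = refl
mirror-step dead          (mk _ _) (mk _ _)      = refl
mirror-step (mid _ _ _ _) (mk _ _) dead          = refl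
mirror-step (mid _ _ _ _) (mk _ _) (mid _ _ _ _) = refl
mirror-step (mid _ _ _ _) (mk _ _) (mk _ _)      = refl
mirror-step (mk _ _)      (mk _ _) dead          = refl
mirror-step (mk _ _)      (mk _ _) (mid _ _ _ _) = refl
mirror-step (mk _ _)      (mk _ _) (mk _ _)      = refl
mirror-step dead (mid _ _ _ _) dead          = refl
mirror-step dead (mid _ _ _ _) (mid _ _ _ _) = refl
mirror-step dead (mid _ _ _ _) (mk _ _)      = refl
mirror-step (mid _ _ _ _) (mid _ _ _ _) dead = refl
mirror-step (mk _ _)      (mid _ _ _ _) dead = refl
mirror-step (mid a _ _ _) (mid _ _ _ _) (mid _ b _ _) rewrite clash-comm b a with clash a b
... | true  = refl
... | false = refl
mirror-step (mid a _ _ _) (mid _ _ _ _) (mk _ b) rewrite clash-comm b a with clash a b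
... | true  = refl
... | false = refl
mirror-step (mk a _) (mid _ _ _ _) (mid _ b _ _) rewrite clash-comm b a with clash a b
... | true  = refl
... | false = refl
mirror-step (mk a _) (mid _ _ _ _) (mk _ b) rewrite clash-comm b a with clash a b
... | true  = refl
... | false = refl

IsMid IsMk IsDead : Shape → Set
IsMid s = type s ≡ mid
IsMk s  = type s ≡ mk
IsDead s = type s ≡ dead

-- The content of a surviving intermediate cell, read off without evaluating the clash test.
record MidStep (l c r : Shape) : Set where
  field
    mid-c  : IsMid c
    live-l : ¬ IsDead l
    live-r : ¬ IsDead r
    apart  : clash (outK l) (inK r) ≡ false
    step≡  : stepShape l c r ≡ mid (outK l) (inK r) (nextOut l (inO c)) (nextIn r (outO c))

live : ∀ {s} → ¬ IsDead s → alive s ≡ true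
live {dead}        d = ⊥-elim (d refl)
live {mid _ _ _ _} d = refl
live {mk _ _}      d = refl

stepShape-mid : ∀ {l c r} → IsMid c → ¬ IsDead l → ¬ IsDead r → clash (outK l) (inK r) ≡ false →
  stepShape l c r ≡ mid (outK l) (inK r) (nextOut l (inO c)) (nextIn r (outO c))
stepShape-mid {l} {mid _ _ _ _} {r} c dl dr e rewrite live {l} dl | live {r} dr | e = refl

midStep : ∀ l c r → IsMid (stepShape l c r) → MidStep l c r
midStep l c@(mid _ _ _ _) r e
  with alive l in al | alive r in ar | clash (outK l) (inK r) in eq
... | true | true | false = record
  { mid-c = refl ; live-l = λ d → dead-alive l d al ; live-r = λ d → dead-alive r d ar ; apart = eq
  ; step≡ = stepShape-mid {l} {c} {r} refl (λ d → dead-alive l d al) (λ d → dead-alive r d ar) eq }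
  where
  dead-alive : ∀ s → IsDead s → alive s ≢ true
  dead-alive dead _ ()

mk-static : ∀ l c r → IsMk c → IsMk (stepShape l c r)
mk-static l (mk _ _) r _ = refl

mk-origin : ∀ l c r → IsMk (stepShape l c r) → IsMk c
mk-origin l (mk _ _) r _ = refl
mk-origin l (mid _ _ _ _) r e with alive l ∧ alive r ∧ not (clash (outK l) (inK r))
mk-origin l (mid _ _ _ _) r () | true
mk-origin l (mid _ _ _ _) r () | false

mk-out : ∀ l c r → IsMk c → IsMid r → outK (stepShape l c r) ≡ inK r
mk-out l (mk _ _) (mid _ _ _ _) _ _ = refl

mk-in : ∀ l c r → IsMk c → IsMid l → inK (stepShape l c r) ≡ outK l
mk-in (mid _ _ _ _) (mk _ _) r _ _ = refl

nextOut-mid : ∀ {s} → IsMid s → ∀ o → nextOut s o ≡ outO s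
nextOut-mid {mid _ _ _ _} _ o = refl

nextIn-mid : ∀ {s} → IsMid s → ∀ o → nextIn s o ≡ inO s
nextIn-mid {mid _ _ _ _} _ o = refl

nextOut-mk : ∀ {s} → IsMk s → ∀ o → nextOut s o ≡ o
nextOut-mk {mk _ _} _ o = refl

nextIn-mk : ∀ {s} → IsMk s → ∀ o → nextIn s o ≡ o
nextIn-mk {mk _ _} _ o = refl

-- Blocks seen from one end

-- A token needs `2 * suc h` steps for a round trip between the markers. The operations turn round
-- before the markers, on a loop of length `2 * h` that carries the same word of length `h` twice.
record Clock (h : ℕ) (c : ℕ → Kind) (x : ℕ → Op) : Set where
  field
    c-period : ∀ n → c (n + (suc h + suc h)) ≡ c n
    c-apart  : ∀ n d → suc d < suc h + suc h → clash (c n) (c (n + suc d)) ≡ false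
    x-period : ∀ n → x (n + h) ≡ x n

record Intact (h : ℕ) (row : ℕ → Shape) : Set where
  field
    start : IsMk (row 0)
    mids  : ∀ u → u < h → IsMid (row (suc u))
    end   : IsMk (row (suc h))

-- A block seen from one of its two markers at time t: the tokens and operations
-- reaching that marker at time t + n are c (t + n) and x (t + n).
record Good (h : ℕ) (c : ℕ → Kind) (x : ℕ → Op) (t : ℕ) (row : ℕ → Shape) : Set where
  field
    intact : Intact h row
    inK≡   : ∀ u → u ≤ h → inK (row (suc u)) ≡ c (t + u)
    outK≡  : ∀ y y′ → y + y′ ≡ h → outK (row y) ≡ c (t + y′ + suc h)
    inO≡   : ∀ u → u < h → inO (row (suc u)) ≡ x (t + u)
    outO≡  : ∀ u u′ → suc (u + u′) ≡ h → outO (row (suc u)) ≡ x (t + u′)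
  open Intact intact public

mid-live : ∀ {s} → IsMid s → ¬ IsDead s
mid-live m d with trans (sym m) d
... | ()

mk-live : ∀ {s} → IsMk s → ¬ IsDead s
mk-live m d with trans (sym m) d
... | ()

mid≢mk : ∀ {s} → IsMid s → ¬ IsMk s
mid≢mk m d with trans (sym m) d
... | ()

intact-live : ∀ {h row} → Intact h row → ∀ y → y ≤ suc h → ¬ IsDead (row y)
intact-live I zero y≤ = mk-live (Intact.start I)
intact-live {h} {row} I (suc y) (s≤s y≤) with m≤n⇒m<n∨m≡n y≤
... | inj₁ y<h  = mid-live (Intact.mids I y y<h)
... | inj₂ refl = mk-live (Intact.end I)

-- The evolution of the half line of cells that starts at a marker; `beyond` is the cell on its other side.
module View
  (V : ℕ → ℕ → Shape) (beyond : ℕ → Shape)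
  (step₀ : ∀ t → V (suc t) 0 ≡ stepShape (beyond t) (V t 0) (V t 1))
  (stepₛ : ∀ t y → V (suc t) (suc y) ≡ stepShape (V t y) (V t (suc y)) (V t (suc (suc y))))
  (k : ℕ)
  where

  private
    h w : ℕ
    h = suc k
    w = suc h

  midStepV : ∀ t y → IsMid (V (suc t) (suc y)) → MidStep (V t y) (V t (suc y)) (V t (suc (suc y)))
  midStepV t y m = midStep _ _ _ (trans (cong type (sym (stepₛ t y))) m)

  mid-stepV : ∀ t y → IsMid (V (suc t) (suc y)) → V (suc t) (suc y) ≡
    mid (outK (V t y)) (inK (V t (suc (suc y))))
        (nextOut (V t y) (inO (V t (suc y)))) (nextIn (V t (suc (suc y))) (outO (V t (suc y))))
  mid-stepV t y m = trans (stepₛ t y) (MidStep.step≡ (midStepV t y m))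

  mid-pred : ∀ t y → IsMid (V (suc t) (suc y)) → IsMid (V t (suc y))
  mid-pred t y m = MidStep.mid-c (midStepV t y m)

  mk-suc : ∀ t y → IsMk (V t y) → IsMk (V (suc t) y)
  mk-suc t zero    m = trans (cong type (step₀ t)) (mk-static _ _ _ m)
  mk-suc t (suc y) m = trans (cong type (stepₛ t y)) (mk-static _ _ _ m)

  mk-pred : ∀ t y → IsMk (V (suc t) y) → IsMk (V t y)
  mk-pred t zero    m = mk-origin _ _ _ (trans (cong type (sym (step₀ t))) m)
  mk-pred t (suc y) m = mk-origin _ _ _ (trans (cong type (sym (stepₛ t y))) m)

  mid-back : ∀ d t y → IsMid (V (d + t) (suc y)) → IsMid (V t (suc y))
  mid-back zero    t y m = m
  mid-back (suc d) t y m = mid-back d t y (mid-pred (d + t) y m)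

  mk-back : ∀ d t y → IsMk (V (d + t) y) → IsMk (V t y)
  mk-back zero    t y m = m
  mk-back (suc d) t y m = mk-back d t y (mk-pred (d + t) y m)

  mk-forth : ∀ d t y → IsMk (V t y) → IsMk (V (d + t) y)
  mk-forth zero    t y m = m
  mk-forth (suc d) t y m = mk-suc (d + t) y (mk-forth d t y m)

  intact-back : ∀ d t → Intact h (V (d + t)) → Intact h (V t)
  intact-back d t I = record
    { start = mk-back d t 0 (Intact.start I)
    ; mids  = λ u u<h → mid-back d t u (Intact.mids I u u<h)
    ; end   = mk-back d t w (Intact.end I) }

  start-out : ∀ t → IsMk (V t 0) → IsMid (V t 1) → outK (V (suc t) 0) ≡ inK (V t 1)
  start-out t m m′ = trans (cong outK (step₀ t)) (mk-out _ _ _ m m′)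

  end-in : ∀ t → Intact h (V t) → inK (V (suc t) w) ≡ outK (V t h)
  end-in t I = trans (cong inK (stepₛ t h)) (mk-in _ _ _ (Intact.end I) (Intact.mids I k ≤-refl))

  module _ {c : ℕ → Kind} {x : ℕ → Op} (C : Clock h c x) where
    open Clock C

    -- An outgoing and an incoming token due at the same cell are `2 * suc u′` arrivals apart, less
    -- than a period, so `c-apart` excludes a clash. A genuine block thus evolves independently of
    -- everything outside.
    good-suc : ∀ t → Good h c x t (V t) → Good h c x (suc t) (V (suc t))
    good-suc t G = record
      { intact = record { start = mk-suc t 0 start ; mids = λ u u<h → cong type (content u (rest u<h) (rest-eq u<h))
                        ; end = mk-suc t w end }
      ; inK≡ = in-suc
      ; outK≡ = out-suc
      ; inO≡ = λ u u<h → trans (cong inO (content u (rest u<h) (rest-eq u<h))) (cong x (+-suc t u))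
      ; outO≡ = λ u u′ e → trans (cong outO (content u u′ e)) (cong x (+-suc t u′)) }
      where
      open Good G

      rest : ∀ {u} → u < h → ℕ
      rest {u} _ = k ∸ u

      rest-eq : ∀ {u} (u<h : u < h) → suc (u + rest u<h) ≡ h
      rest-eq (s≤s u≤k) = cong suc (m+[n∸m]≡n u≤k)

      next-out : ∀ u u′ → suc (u + u′) ≡ h → nextOut (V t u) (inO (V t (suc u))) ≡ x (t + suc u′)
      -- Here the operation turns round next to the marker; the period `h` of `x` compensates for
      -- the change of lane.
      next-out zero u′ refl = trans (nextOut-mk start _)
        (trans (inO≡ 0 z<s) (trans (cong x (+-identityʳ t)) (sym (x-period t))))
      next-out (suc v) u′ e = trans (nextOut-mid (mids v (v<h e)) _)
        (outO≡ v (suc u′) (trans (cong suc (+-suc v u′)) e))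
        where
        v<h : suc (suc v + u′) ≡ h → v < h
        v<h e = subst (v <_) e (s≤s (≤-trans (m≤m+n v u′) (n≤1+n _)))

      next-in : ∀ u u′ → suc (u + u′) ≡ h → nextIn (V t (suc (suc u))) (outO (V t (suc u))) ≡ x (t + suc u)
      next-in u zero e = trans (nextIn-mk (subst (λ n → IsMk (V t (suc n))) (sym u+1≡h) end) _)
        (trans (outO≡ u 0 e) (trans (cong x (+-identityʳ t))
          (trans (sym (x-period t)) (cong (λ n → x (t + n)) (sym u+1≡h)))))
        where
        u+1≡h : suc u ≡ h
        u+1≡h = trans (cong suc (sym (+-identityʳ u))) e
      next-in u (suc v) e = trans (nextIn-mid (mids (suc u) su<h) _) (inO≡ (suc u) su<h)
        where
        su<h : suc u < h
        su<h = subst (suc u <_) e (s≤s (≤-trans (s≤s (m≤m+n u v)) (≤-reflexive (sym (+-suc u v)))))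

      content : ∀ u u′ → suc (u + u′) ≡ h → V (suc t) (suc u) ≡
        mid (c (t + suc u′ + w)) (c (t + suc u)) (x (t + suc u′)) (x (t + suc u))
      content u u′ e = trans (stepₛ t u) (trans
        (stepShape-mid (mids u u<h) (intact-live intact u (≤-trans (<⇒≤ u<h) (n≤1+n h)))
          (intact-live intact (suc (suc u)) (s≤s u<h)) no-clash)
        (trans (cong₂ (λ a b → mid a b _ _) out-l in-r)
               (cong₂ (mid _ _) (next-out u u′ e) (next-in u u′ e))))
        where
        u<h : u < h
        u<h = subst (u <_) e (s≤s (m≤m+n u u′))
        out-l : outK (V t u) ≡ c (t + suc u′ + w)
        out-l = outK≡ u (suc u′) (trans (+-suc u u′) e)
        in-r : inK (V t (suc (suc u))) ≡ c (t + suc u)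
        in-r = inK≡ (suc u) u<h
        shift : t + suc u + suc (u′ + suc u′) ≡ t + suc u′ + w
        shift = trans (lem t u u′) (cong (λ n → t + suc u′ + suc n) e)
          where
          lem : ∀ t u u′ → t + suc u + suc (u′ + suc u′) ≡ t + suc u′ + suc (suc (u + u′))
          lem = solve-∀
        small : suc (u′ + suc u′) < w + w
        small = s≤s (s≤s (+-mono-≤ u′≤k (s≤s (≤-trans u′≤k (n≤1+n k)))))
          where
          u′≤k : u′ ≤ k
          u′≤k = subst (u′ ≤_) (suc-injective e) (m≤n+m u′ u)
        no-clash : clash (outK (V t u)) (inK (V t (suc (suc u)))) ≡ false
        no-clash = trans (cong₂ clash out-l in-r) (trans (clash-comm (c (t + suc u′ + w)) (c (t + suc u)))
          (trans (cong (λ n → clash (c (t + suc u)) (c n)) (sym shift)) (c-apart (t + suc u) (u′ + suc u′) small)))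

      in-suc : ∀ u → u ≤ h → inK (V (suc t) (suc u)) ≡ c (suc t + u)
      in-suc u u≤h with m≤n⇒m<n∨m≡n u≤h
      ... | inj₁ u<h  = trans (cong inK (content u (rest u<h) (rest-eq u<h))) (cong c (+-suc t u))
      ... | inj₂ refl = trans (end-in t intact) (trans (outK≡ h 0 (+-identityʳ h))
                          (cong c (trans (cong (_+ w) (+-identityʳ t)) (+-suc t h))))

      out-suc : ∀ y y′ → y + y′ ≡ h → outK (V (suc t) y) ≡ c (suc t + y′ + w)
      out-suc zero y′ refl = trans (start-out t start (mids 0 z<s)) (trans (inK≡ 0 z≤n)
        (trans (sym (c-period (t + 0))) (cong c (lem t h))))
        where
        lem : ∀ t h → t + 0 + (suc h + suc h) ≡ suc t + h + suc h
        lem = solve-∀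
      out-suc (suc u) u′ e = trans (cong outK (content u u′ e)) (cong (λ n → c (n + w)) (+-suc t u′))

    good-forth : ∀ d t → Good h c x t (V t) → Good h c x (d + t) (V (d + t))
    good-forth zero    t G = G
    good-forth (suc d) t G = good-suc (d + t) (good-forth d t G)

  arrival : ℕ → Kind
  arrival t = inK (V t 1)

  arrivalO : ℕ → Op
  arrivalO t = inO (V t 1)

  -- While a block stays intact, its whole content can be read off from the arrivals at its end.
  trace-in : ∀ u t → u ≤ h → Intact h (V (u + t)) → inK (V t (suc u)) ≡ arrival (t + u)
  trace-in zero    t _   I = cong arrival (sym (+-identityʳ t))
  trace-in (suc u) t u<h I = trans
    (sym (cong inK (mid-stepV t u (Intact.mids (intact-back u (suc t) I′) u u<h))))
    (trans (trace-in u (suc t) (<⇒≤ u<h) I′) (cong arrival (sym (+-suc t u))))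
    where
    I′ : Intact h (V (u + suc t))
    I′ = subst (λ n → Intact h (V n)) (sym (+-suc u t)) I

  -- The token is reflected by the far marker after `suc y′` steps and then takes `h` steps to the
  -- near end.
  trace-out : ∀ y y′ t → y + y′ ≡ h → Intact h (V (y′ + w + t)) → outK (V t y) ≡ arrival (t + y′ + w)
  trace-out y zero t e I with trans (sym (+-identityʳ y)) e
  ... | refl = trans (sym (end-in t (intact-back w t I))) (trans (trace-in h (suc t) ≤-refl I′) (cong arrival (lem t h)))
    where
    I′ : Intact h (V (h + suc t))
    I′ = subst (λ n → Intact h (V n)) (sym (+-suc h t)) I
    lem : ∀ t h → suc t + h ≡ t + 0 + suc h
    lem = solve-∀
  trace-out y (suc y′) t e I = trans
    (sym (cong outK (mid-stepV t y (Intact.mids (intact-back (y′ + w) (suc t) I′) y y<h))))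
    (trans (trace-out (suc y) y′ (suc t) (trans (sym (+-suc y y′)) e) I′)
           (cong (λ n → arrival (n + w)) (sym (+-suc t y′))))
    where
    I′ : Intact h (V (y′ + w + suc t))
    I′ = subst (λ n → Intact h (V n)) (sym (+-suc (y′ + w) t)) I
    y<h : y < h
    y<h = subst (suc y ≤_) (trans (sym (+-suc y y′)) e) (s≤s (m≤m+n y y′))

  trace-inO : ∀ u t → u < h → Intact h (V (u + t)) → inO (V t (suc u)) ≡ arrivalO (t + u)
  trace-inO zero    t _   I = cong arrivalO (sym (+-identityʳ t))
  trace-inO (suc u) t su<h I = trans
    (sym (trans (cong inO (mid-stepV t u (Intact.mids I₁ u u<h)))
                (nextIn-mid (Intact.mids (intact-back 1 t I₁) (suc u) su<h) _)))
    (trans (trace-inO u (suc t) u<h I′) (cong arrivalO (sym (+-suc t u))))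
    where
    u<h : u < h
    u<h = <⇒≤ su<h
    I′ : Intact h (V (u + suc t))
    I′ = subst (λ n → Intact h (V n)) (sym (+-suc u t)) I
    I₁ : Intact h (V (suc t))
    I₁ = intact-back u (suc t) I′

  trace-outO : ∀ u u′ t → suc (u + u′) ≡ h → Intact h (V (u′ + h + t)) → outO (V t (suc u)) ≡ arrivalO (t + u′ + h)
  trace-outO u zero t e I with trans (sym (+-identityʳ u)) (suc-injective e)
  ... | refl = trans
    (sym (trans (cong inO (mid-stepV t k (Intact.mids I₁ k ≤-refl))) (nextIn-mk (Intact.end (intact-back 1 t I₁)) _)))
    (trans (trace-inO k (suc t) ≤-refl I′) (cong arrivalO (lem t k)))
    where
    I′ : Intact h (V (k + suc t))
    I′ = subst (λ n → Intact h (V n)) (sym (+-suc k t)) I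
    I₁ : Intact h (V (suc t))
    I₁ = intact-back k (suc t) I′
    lem : ∀ t k → suc t + k ≡ t + 0 + suc k
    lem = solve-∀
  trace-outO u (suc u′) t e I = trans
    (sym (trans (cong outO (mid-stepV t (suc u) (Intact.mids I₁ (suc u) su<h)))
                (nextOut-mid (Intact.mids (intact-back 1 t I₁) u (<⇒≤ su<h)) _)))
    (trans (trace-outO (suc u) u′ (suc t) (trans (cong suc (sym (+-suc u u′))) e) I′)
           (cong (λ n → arrivalO (n + h)) (sym (+-suc t u′))))
    where
    su<h : suc u < h
    su<h = subst (suc (suc u) ≤_) (trans (cong suc (sym (+-suc u u′))) e) (s≤s (s≤s (m≤m+n u u′)))
    I′ : Intact h (V (u′ + h + suc t))
    I′ = subst (λ n → Intact h (V n)) (sym (+-suc (u′ + h) t)) I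
    I₁ : Intact h (V (suc t))
    I₁ = intact-back (u′ + h) (suc t) I′

  intact-≤ : ∀ {m n} → m ≤ n → Intact h (V n) → Intact h (V m)
  intact-≤ {m} {n} m≤n I = intact-back (n ∸ m) m (subst (λ i → Intact h (V i)) (sym (m∸n+n≡m m≤n)) I)

  module _ {c : ℕ → Kind} {x : ℕ → Op} (C : Clock h c x) where
    open Clock C

    -- Every token and operation of the block passes the near end within one round trip, so these
    -- arrivals spell out the whole content at time `t`.
    good-from-arrivals : ∀ t → Intact h (V (w + w + t)) →
      (∀ d → d < w + w → arrival (t + d) ≡ c (t + d)) →
      (∀ d → d < w + w → arrivalO (t + d) ≡ x (t + d)) →
      Good h c x t (V t)
    good-from-arrivals t I A O = record
      { intact = intact-back (w + w) t I
      ; inK≡   = λ u u≤h → trans (trace-in u t u≤h (intact-≤ (+-monoˡ-≤ t (≤-trans u≤h h≤2w)) I))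
                                 (A u (<-≤-trans (s≤s u≤h) (m≤m+n w w)))
      ; outK≡  = λ y y′ e → trans
          (trace-out y y′ t e (intact-≤ (+-monoˡ-≤ t (+-monoˡ-≤ w (≤-trans (y′≤h y e) (n≤1+n h)))) I))
          (trans (cong arrival (+-assoc t y′ w))
            (trans (A (y′ + w) (+-monoˡ-< w (s≤s (y′≤h y e)))) (cong c (sym (+-assoc t y′ w)))))
      ; inO≡   = λ u u<h → trans (trace-inO u t u<h (intact-≤ (+-monoˡ-≤ t (≤-trans (<⇒≤ u<h) h≤2w)) I))
                                 (O u (<-≤-trans (s≤s (<⇒≤ u<h)) (m≤m+n w w)))
      ; outO≡  = λ u u′ e → let u′<w = s≤s (≤-trans (m≤n+m u′ (suc u)) (≤-reflexive e)) in trans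
          (trace-outO u u′ t e (intact-≤ (+-monoˡ-≤ t (+-mono-≤ (<⇒≤ u′<w) (n≤1+n h))) I))
          (trans (cong arrivalO (+-assoc t u′ h))
            (trans (O (u′ + h) (+-mono-<-≤ u′<w (n≤1+n h)))
              (trans (cong x (sym (+-assoc t u′ h))) (x-period (t + u′))))) }
      where
      h≤2w : h ≤ w + w
      h≤2w = ≤-trans (n≤1+n h) (m≤m+n w w)
      y′≤h : ∀ y {y′} → y + y′ ≡ h → y′ ≤ h
      y′≤h y {y′} e = ≤-trans (m≤n+m y′ y) (≤-reflexive e)

  -- Only the cell next to the marker is observed, during a single period. The aim is `intact₀`: the
  -- next marker stands at distance exactly `w`.
  module Core (c₀ : Kind) (clash₀ : clash c₀ c₀ ≡ true) (t₀ : ℕ)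
    (start : IsMk (V t₀ 0))
    (mids₁ : ∀ d → d ≤ w + w → IsMid (V (d + t₀) 1))
    (first : arrival t₀ ≡ c₀) (last : arrival (w + w + t₀) ≡ c₀)
    (between : ∀ d → suc d < w + w → arrival (suc d + t₀) ≢ c₀)
    where

    out-back : ∀ y m → (∀ u → u < y → IsMid (V (y + m) (suc u))) → outK (V (y + m) y) ≡ outK (V m 0)
    out-back zero    m M = refl
    out-back (suc y) m M = trans (cong outK (mid-stepV (y + m) y (M y ≤-refl)))
      (out-back y m (λ u u<y → mid-pred (y + m) u (M u (<⇒≤ (s≤s u<y)))))

    record Back (s n : ℕ) : Set where
      field
        alive-at : ¬ IsDead (V (n + t₀) (suc s))
        in-at    : inK (V (n + t₀) (suc s)) ≡ c₀
        mids-at  : ∀ u → u < s → IsMid (V (n + t₀) (suc u))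

    type-cases : ∀ s → ¬ IsDead s → IsMid s ⊎ IsMk s
    type-cases dead          d = ⊥-elim (d refl)
    type-cases (mid _ _ _ _) d = inj₁ refl
    type-cases (mk _ _)      d = inj₂ refl

    -- Follow the last arrival of c₀ back in time.  A marker at a distance smaller than w
    -- would turn it into an arrival of c₀ strictly between t₀ and t₀ + 2w.
    back : ∀ s n → s ≤ h → n + s ≡ w + w → Back s n
    back zero n _ e with trans (sym (+-identityʳ n)) e
    ... | refl = record { alive-at = mid-live (mids₁ (w + w) ≤-refl) ; in-at = last ; mids-at = λ _ () }
    back (suc s) n s<h e with back s (suc n) (<⇒≤ s<h) (trans (sym (+-suc n s)) e)
    ... | B with type-cases _ (Back.alive-at B)
    ... | inj₁ m = record
      { alive-at = MidStep.live-r (midStepV (n + t₀) s m)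
      ; in-at = trans (sym (cong inK (mid-stepV (n + t₀) s m))) (Back.in-at B)
      ; mids-at = λ u u≤s → mid-pred (n + t₀) u (mids′ u u≤s) }
      where
      mids′ : ∀ u → u < suc s → IsMid (V (suc n + t₀) (suc u))
      mids′ u (s≤s u≤s) with m≤n⇒m<n∨m≡n u≤s
      ... | inj₁ u<s  = Back.mids-at B u u<s
      ... | inj₂ refl = m
    back (suc zero) n s<h e | B | inj₂ m = ⊥-elim
        (mid≢mk (mids₁ (suc n) (≤-trans (m≤m+n (suc n) 0) (≤-reflexive (trans (sym (+-suc n 0)) e)))) m)
    back (suc (suc s)) n s<h e | B | inj₂ m = ⊥-elim (between d d< (trans (sym emitted) early))
      where
      -- A marker at distance `suc (suc s)` would have sent back the token that arrived at time
      -- `suc d + t₀`; here `suc d` is twice the distance from that marker to cell `w`.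
      r d : ℕ
      r = k ∸ suc s
      d = suc (r + r)
      split : suc (suc s) + r ≡ h
      split = cong suc (m+[n∸m]≡n (≤-pred s<h))
      n≡ : n ≡ suc s + suc (suc d)
      n≡ = +-cancelʳ-≡ (suc (suc s)) n _ (trans e (trans (cong (λ h → suc h + suc h) (sym split)) (lem s r)))
        where
        lem : ∀ s r → suc (suc (suc s) + r) + suc (suc (suc s) + r) ≡ suc s + suc (suc (suc (r + r))) + suc (suc s)
        lem = solve-∀
      n+t≡ : n + t₀ ≡ suc s + (suc (suc d) + t₀)
      n+t≡ = trans (cong (_+ t₀) n≡) (+-assoc (suc s) (suc (suc d)) t₀)
      mids″ : ∀ u → u < suc s → IsMid (V (suc s + (suc (suc d) + t₀)) (suc u))
      mids″ u u< = subst (λ i → IsMid (V i (suc u))) n+t≡ (mid-pred (n + t₀) u (Back.mids-at B u u<))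
      early : outK (V (suc (suc d) + t₀) 0) ≡ c₀
      early = trans (sym (out-back (suc s) (suc (suc d) + t₀) mids″))
        (trans (cong (λ i → outK (V i (suc s))) (sym n+t≡))
          (trans (sym (trans (cong inK (stepₛ (n + t₀) (suc s)))
            (mk-in _ _ _ (mk-pred (n + t₀) (suc (suc s)) m) (mid-pred (n + t₀) s (Back.mids-at B s ≤-refl)))))
            (Back.in-at B)))
      d< : suc d < w + w
      d< = s≤s (s≤s (≤-trans (≤-reflexive (sym (+-suc r r))) (+-mono-≤ r≤k (s≤s (≤-trans r≤k (n≤1+n k))))))
        where
        r≤k : r ≤ k
        r≤k = m∸n≤m k (suc s)
      emitted : outK (V (suc (suc d) + t₀) 0) ≡ arrival (suc d + t₀)
      emitted = start-out (suc d + t₀) (mk-forth (suc d) t₀ 0 start) (mids₁ (suc d) (<⇒≤ d<))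

    -- The token sent at time `suc t₀` and the one that arrives at time `w + w + t₀` are both due at
    -- cell `w` at time `suc w + t₀`. An intermediate cell would die of this clash, but the cell is
    -- alive, so it is a marker.
    intact₀ : Intact h (V t₀)
    intact₀ with back h (suc w) ≤-refl (cong suc (sym (+-suc h h)))
    ... | B with type-cases _ (Back.alive-at B)
    ... | inj₂ m = record { start = start ; mids = λ u u<h → mid-back (suc w) t₀ u (Back.mids-at B u u<h)
                          ; end = mk-back (suc w) t₀ w m }
    ... | inj₁ m = ⊥-elim (absurd (trans (sym (trans (cong₂ clash sent returned) clash₀))
        (MidStep.apart (midStepV (w + t₀) h m))))
      where
      absurd : true ≢ false
      absurd ()
      returned : inK (V (w + t₀) (suc w)) ≡ c₀
      returned = trans (sym (cong inK (mid-stepV (w + t₀) h m))) (Back.in-at B)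
      sent : outK (V (w + t₀) h) ≡ c₀
      sent = trans (cong (λ i → outK (V i h)) (sym (+-suc h t₀)))
        (trans (out-back h (suc t₀) (λ u u<h → subst (λ i → IsMid (V i (suc u))) (sym (+-suc h t₀))
            (mid-pred (w + t₀) u (Back.mids-at B u u<h))))
          (trans (start-out t₀ start (mids₁ 0 z≤n)) first))

  module _ {c : ℕ → Kind} {x : ℕ → Op} (C : Clock h c x) where
    open Clock C

    -- Two periods are observed. By `Core`, the second shows that the block is still intact at the
    -- end of the first, and then the arrivals of the first determine its content.
    good-exact : ∀ c₀ → clash c₀ c₀ ≡ true → c 0 ≡ c₀ →
      IsMk (V 0 0) →
      (∀ t → t ≤ (w + w) + (w + w) → IsMid (V t 1) × arrival t ≡ c t × arrivalO t ≡ x t) →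
      Good h c x 0 (V 0)
    good-exact c₀ clash₀ c0≡ start A = good-from-arrivals C 0
      (subst (λ i → Intact h (V i)) (sym (+-identityʳ (w + w))) intact₀)
      (λ d d< → proj₁ (proj₂ (A d (early (<⇒≤ d<)))))
      (λ d d< → proj₂ (proj₂ (A d (early (<⇒≤ d<)))))
      where
      c≢ : ∀ d → suc d < w + w → c (suc d) ≢ c₀
      c≢ d d< e with trans (sym (c-apart 0 d d<)) (trans (cong₂ clash c0≡ e) clash₀)
      ... | ()
      early : ∀ {d} → d ≤ w + w → d ≤ (w + w) + (w + w)
      early d≤ = ≤-trans d≤ (m≤m+n (w + w) (w + w))
      c-at : ∀ d → d ≤ w + w → arrival (d + (w + w)) ≡ c d
      c-at d d≤ = trans (proj₁ (proj₂ (A (d + (w + w)) (+-monoˡ-≤ (w + w) d≤)))) (c-period d)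
      open Core c₀ clash₀ (w + w)
        (subst (λ i → IsMk (V i 0)) (+-identityʳ (w + w)) (mk-forth (w + w) 0 0 start))
        (λ d d≤ → proj₁ (A (d + (w + w)) (+-monoˡ-≤ (w + w) d≤)))
        (trans (c-at 0 z≤n) c0≡)
        (trans (proj₁ (proj₂ (A (w + w + (w + w)) ≤-refl))) (trans (c-period (w + w)) (trans (c-period 0) c0≡)))
        (λ d d< e → c≢ d d< (trans (sym (c-at (suc d) (<⇒≤ d<))) e))

    -- Intactness extends to the past, since no cell ever becomes a marker or an intermediate cell.
    -- An intact block is a closed loop, so its arrivals are periodic; if they follow the clock from
    -- `T` on, they have always done so.
    good-origin : ∀ T → Good h c x T (V T) → Good h c x 0 (V 0)
    good-origin T G = good-from-arrivals C 0 (intact _) (λ d _ → arr d) (λ d _ → arrO d)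
      where
      later : ∀ t → T ≤ t → Good h c x t (V t)
      later t T≤t = subst (λ i → Good h c x i (V i)) (m∸n+n≡m T≤t) (good-forth C (t ∸ T) T G)
      intact : ∀ t → Intact h (V t)
      intact t = intact-≤ (m≤n+m t T) (Good.intact (later (T + t) (m≤m+n T t)))
      loop : ∀ t → arrival t ≡ arrival (t + (w + w))
      loop t = trans (sym (start-out t (Intact.start (intact t)) (Intact.mids (intact t) 0 z<s)))
        (trans (trace-out 0 h (suc t) refl (intact _)) (cong arrival (lem t h)))
        where
        lem : ∀ t h → suc t + h + suc h ≡ t + (suc h + suc h)
        lem = solve-∀
      loopO : ∀ t → arrivalO t ≡ arrivalO (t + (h + h))
      loopO t = trans (sym (trans (cong outO (mid-stepV t 0 (Intact.mids (intact (suc t)) 0 z<s)))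
                                  (nextOut-mk (Intact.start (intact t)) _)))
        (trans (trace-outO 0 k (suc t) refl (intact _)) (cong arrivalO (lem t k)))
        where
        lem : ∀ t k → suc t + k + suc k ≡ t + (suc k + suc k)
        lem = solve-∀
      loops : ∀ {A : Set} (f : ℕ → A) p → (∀ t → f t ≡ f (t + p)) → ∀ m t → f t ≡ f (t + m * p)
      loops f p e zero    t = cong f (sym (+-identityʳ t))
      loops f p e (suc m) t = trans (e t) (trans (loops f p e m (t + p)) (cong f (+-assoc t p (m * p))))
      far : ∀ p → .{{NonZero p}} → ∀ t → T ≤ t + T * p
      far p t = ≤-trans (m≤m*n T p) (m≤n+m (T * p) t)
      arr : ∀ t → arrival t ≡ c t
      arr t = trans (loops arrival (w + w) loop T t)
        (trans (trans (Good.inK≡ (later _ (far (w + w) t)) 0 z≤n) (cong c (+-identityʳ _)))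
          (sym (loops c (w + w) (λ n → sym (c-period n)) T t)))
      arrO : ∀ t → arrivalO t ≡ x t
      arrO t = trans (loops arrivalO (h + h) loopO T t)
        (trans (trans (Good.inO≡ (later _ (far (h + h) t)) 0 z<s) (cong x (+-identityʳ _)))
          (sym (loops x (h + h) (λ n → sym (trans (cong x (sym (+-assoc n h h)))
              (trans (x-period (n + h)) (x-period n)))) T t)))

-- Blocks seen from the other end, and decidability of `Good`

type-mirror : ∀ s → type (mirror s) ≡ type s
type-mirror dead          = refl
type-mirror (mid _ _ _ _) = refl
type-mirror (mk _ _)      = refl

in-mirror : ∀ s → inK (mirror s) ≡ outK s
in-mirror dead          = refl
in-mirror (mid _ _ _ _) = refl
in-mirror (mk _ _)      = refl

out-mirror : ∀ s → outK (mirror s) ≡ inK s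
out-mirror dead          = refl
out-mirror (mid _ _ _ _) = refl
out-mirror (mk _ _)      = refl

inO-mirror : ∀ s → inO (mirror s) ≡ outO s
inO-mirror dead          = refl
inO-mirror (mid _ _ _ _) = refl
inO-mirror (mk _ _)      = refl

outO-mirror : ∀ s → outO (mirror s) ≡ inO s
outO-mirror dead          = refl
outO-mirror (mid _ _ _ _) = refl
outO-mirror (mk _ _)      = refl

mirror-mirror : ∀ s → mirror (mirror s) ≡ s
mirror-mirror dead          = refl
mirror-mirror (mid _ _ _ _) = refl
mirror-mirror (mk _ _)      = refl

-- From the other end the tokens appear shifted by half a period, whereas the operations look the
-- same.
good-mirror : ∀ {h c c′ x t row row′} → (∀ y y′ → y + y′ ≡ suc h → row′ y′ ≡ mirror (row y)) →
  (∀ n → c′ n ≡ c (n + suc h)) → (∀ n → c n ≡ c′ (n + suc h)) → Good h c x t row → Good h c′ x t row′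
good-mirror {h} {c} {c′} {x} {t} {row} {row′} M c′≡ c≡ G = record
  { intact = record
      { start = trans (cong type (M (suc h) 0 (+-identityʳ (suc h)))) (trans (type-mirror (row (suc h))) end)
      ; mids  = λ u u<h → trans (cong type (M (suc (h ∸ suc u)) (suc u) (cong suc (m∸n+n≡m u<h))))
                  (trans (type-mirror (row (suc (h ∸ suc u)))) (mids (h ∸ suc u) (h∸<h u u<h)))
      ; end   = trans (cong type (M 0 (suc h) refl)) (trans (type-mirror (row 0)) start) }
  ; inK≡  = λ u u≤h → trans (cong inK (M (h ∸ u) (suc u) (trans (+-suc (h ∸ u) u) (cong suc (m∸n+n≡m u≤h)))))
              (trans (in-mirror (row (h ∸ u))) (trans (outK≡ (h ∸ u) u (m∸n+n≡m u≤h)) (sym (c′≡ (t + u)))))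
  ; outK≡ = λ y y′ e → trans (cong outK (M (suc y′) y (cong suc (trans (+-comm y′ y) e))))
              (trans (out-mirror (row (suc y′))) (trans (inK≡ y′ (≤-trans (m≤n+m y′ y) (≤-reflexive e))) (c≡ (t + y′))))
  ; inO≡  = λ u u<h → trans (cong inO (M (suc (h ∸ suc u)) (suc u) (cong suc (m∸n+n≡m u<h))))
              (trans (inO-mirror (row (suc (h ∸ suc u))))
                (outO≡ (h ∸ suc u) u (trans (sym (+-suc (h ∸ suc u) u)) (m∸n+n≡m u<h))))
  ; outO≡ = λ u u′ e → trans (cong outO (M (suc u′) (suc u)
      (cong suc (trans (+-suc u′ u) (trans (cong suc (+-comm u′ u)) e)))))
              (trans (outO-mirror (row (suc u′))) (inO≡ u′ (≤-trans (s≤s (m≤n+m u′ u)) (≤-reflexive e)))) }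
  where
  open Good G
  h∸<h : ∀ u → u < h → h ∸ suc u < h
  h∸<h u u<h = ∸-monoʳ-< {h} z<s u<h

good-retime : ∀ {h c x t t′ row} → (∀ n → c (t + n) ≡ c (t′ + n)) → (∀ n → x (t + n) ≡ x (t′ + n)) →
  Good h c x t row → Good h c x t′ row
good-retime {h} {c} {x} {t} {t′} c≡ x≡ G = record
  { intact = intact
  ; inK≡  = λ u u≤h → trans (inK≡ u u≤h) (c≡ u)
  ; outK≡ = λ y y′ e → trans (outK≡ y y′ e) (trans (cong c (+-assoc t y′ (suc h)))
              (trans (c≡ (y′ + suc h)) (cong c (sym (+-assoc t′ y′ (suc h))))))
  ; inO≡  = λ u u<h → trans (inO≡ u u<h) (x≡ u)
  ; outO≡ = λ u u′ e → trans (outO≡ u u′ e) (x≡ u′) }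
  where open Good G

good-cong : ∀ {h c x t row row′} → (∀ y → y ≤ suc h → row y ≡ row′ y) → Good h c x t row → Good h c x t row′
good-cong {h} {row = row} {row′} E G = record
  { intact = record { start = subst IsMk (E 0 z≤n) start ; mids = λ u u<h → subst IsMid (E (suc u) (s≤s (<⇒≤ u<h)))
      (mids u u<h)
                    ; end = subst IsMk (E (suc h) ≤-refl) end }
  ; inK≡  = λ u u≤h → trans (cong inK (sym (E (suc u) (s≤s u≤h)))) (inK≡ u u≤h)
  ; outK≡ = λ y y′ e → trans (cong outK (sym (E y (≤-trans (m≤m+n y y′) (≤-trans (≤-reflexive e) (n≤1+n h))))))
      (outK≡ y y′ e)
  ; inO≡  = λ u u<h → trans (cong inO (sym (E (suc u) (s≤s (<⇒≤ u<h))))) (inO≡ u u<h)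
  ; outO≡ = λ u u′ e → trans (cong outO (sym (E (suc u)
      (s≤s (≤-trans (m≤m+n u u′) (≤-trans (n≤1+n _) (≤-reflexive e))))))) (outO≡ u u′ e) }
  where open Good G

_≟ᵗ_ : DecidableEquality Type
dead ≟ᵗ dead = yes refl
dead ≟ᵗ mid  = no λ ()
dead ≟ᵗ mk   = no λ ()
mid  ≟ᵗ dead = no λ ()
mid  ≟ᵗ mid  = yes refl
mid  ≟ᵗ mk   = no λ ()
mk   ≟ᵗ dead = no λ ()
mk   ≟ᵗ mid  = no λ ()
mk   ≟ᵗ mk   = yes refl

-- `Good` without quantification over pairs, as a conjunction of bounded checks.
private
  Checks : ℕ → (ℕ → Kind) → (ℕ → Op) → ℕ → (ℕ → Shape) → Set
  Checks h c x t row =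
    type (row 0) ≡ mk × (∀ {u} → u < h → type (row (suc u)) ≡ mid) × type (row (suc h)) ≡ mk
    × (∀ {u} → u < suc h → inK (row (suc u)) ≡ c (t + u))
    × (∀ {y} → y < suc h → outK (row y) ≡ c (t + (h ∸ y) + suc h))
    × (∀ {u} → u < h → inO (row (suc u)) ≡ x (t + u))
    × (∀ {u} → u < h → outO (row (suc u)) ≡ x (t + (h ∸ suc u)))

  checked : ∀ {h c x t row} → Checks h c x t row → Good h c x t row
  checked {h} {c} {x} {t} (s , m , e , i , o , p , q) = record
    { intact = record { start = s ; mids = λ _ → m ; end = e }
    ; inK≡ = λ u u≤h → i (s≤s u≤h)
    ; outK≡ = λ y y′ e → trans (o (s≤s (≤-trans (m≤m+n y y′) (≤-reflexive e)))) (cong (λ n → c (t + n + suc h)) (∸≡ e))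
    ; inO≡ = λ _ → p
    ; outO≡ = λ u u′ e → trans (q (≤-trans (s≤s (m≤m+n u u′)) (≤-reflexive e))) (cong (λ n → x (t + n)) (∸≡ e)) }
    where
    ∸≡ : ∀ {a b n} → a + b ≡ n → n ∸ a ≡ b
    ∸≡ {a} {b} refl = m+n∸m≡n a b

  check : ∀ {h c x t row} → Good h c x t row → Checks h c x t row
  check {h} {c} {x} {t} {row} G = start , mids _ , end , (λ { (s≤s u≤h) → inK≡ _ u≤h })
    , (λ { (s≤s y≤h) → outK≡ _ _ (m+[n∸m]≡n y≤h) })
    , inO≡ _ , (λ u<h → outO≡ _ _ (m+[n∸m]≡n u<h))
    where open Good G

abstract

  good? : ∀ h c x t row → Dec (Good h c x t row)
  good? h c x t row = map′ checked check
    ((type (row 0) ≟ᵗ mk) ×-dec allUpTo? (λ u → type (row (suc u)) ≟ᵗ mid) h ×-dec (type (row (suc h)) ≟ᵗ mk)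
     ×-dec allUpTo? (λ u → inK (row (suc u)) ≟ᵏ c (t + u)) (suc h)
     ×-dec allUpTo? (λ y → outK (row y) ≟ᵏ c (t + (h ∸ y) + suc h)) (suc h)
     ×-dec allUpTo? (λ u → inO (row (suc u)) ≟ᵒ x (t + u)) h
     ×-dec allUpTo? (λ u → outO (row (suc u)) ≟ᵒ x (t + (h ∸ suc u))) h)

-- Periodic clocks and schedules

m+n≡m-mod : ∀ n m p .{{_ : NonZero p}} → m < p → (n + m) % p ≡ n % p → m ≡ 0
m+n≡m-mod n m p m<p e = case r + m <? p of λ
  { (yes lt) → +-cancelˡ-≡ r m 0 (trans (trans (sym (m<n⇒m%n≡m lt)) shifted) (sym (+-identityʳ r)))
  ; (no ge)  → let le = ≮⇒≥ ge
                   d  = r + m ∸ p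
                   d+p : d + p ≡ r + m
                   d+p = m∸n+n≡m le
                   d<p : d < p
                   d<p = +-cancelʳ-< p d p (subst (_< p + p) (sym d+p) (+-mono-< (m%n<n n p) m<p))
                   d≡r : d ≡ r
                   d≡r = trans (sym (m<n⇒m%n≡m d<p)) (trans (sym ([m+n]%n≡m%n d p)) (trans (cong (_% p) d+p) shifted))
               in contradiction (+-cancelˡ-≡ r p m (trans (cong (_+ p) (sym d≡r)) d+p)) (>⇒≢ m<p) }
  where
  r = n % p
  shifted : (r + m) % p ≡ r
  shifted = trans (sym ([m+kn]%n≡m%n (r + m) (n / p) p))
    (trans (cong (_% p) (trans (lem r m (n / p * p)) (cong (_+ m) (sym (m≡m%n+[m/n]*n n p))))) e)
    where
    lem : ∀ r m q → r + m + q ≡ r + q + m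
    lem = solve-∀

tick : ℕ → ℕ → Kind
tick w r with r ≟ⁿ 0 | r ≟ⁿ w
... | yes _ | _     = ●
... | no _  | yes _ = ○
... | no _  | no _  = ∅

tick-● : ∀ w r → tick w r ≡ ● → r ≡ 0
tick-● w r e with r ≟ⁿ 0 | r ≟ⁿ w
tick-● w r e  | yes r≡0 | _     = r≡0
tick-● w r () | no _    | yes _
tick-● w r () | no _    | no _

tick-○ : ∀ w r → tick w r ≡ ○ → r ≡ w
tick-○ w r e with r ≟ⁿ 0 | r ≟ⁿ w
tick-○ w r () | yes _ | _
tick-○ w r e  | no _  | yes r≡w = r≡w
tick-○ w r () | no _  | no _

tick-∅ : ∀ w r → r ≢ 0 → r ≢ w → tick w r ≡ ∅
tick-∅ w r r≢0 r≢w with r ≟ⁿ 0 | r ≟ⁿ w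
... | yes r≡0 | _       = ⊥-elim (r≢0 r≡0)
... | no _    | yes r≡w = ⊥-elim (r≢w r≡w)
... | no _    | no _    = refl

tick-w : ∀ h → tick (suc h) (suc h) ≡ ○
tick-w h with suc h ≟ⁿ suc h
... | yes _ = refl
... | no ne = ⊥-elim (ne refl)

%-half : ∀ w n .{{_ : NonZero (w + w)}} → w < w + w → (n + w) % (w + w) ≡ (n % (w + w) + w) % (w + w)
%-half w n w< = trans (%-distribˡ-+ n w (w + w)) (cong (λ r → (n % (w + w) + r) % (w + w)) (m<n⇒m%n≡m w<))

tick-half : ∀ h n → tick (suc h) ((n + suc h) % (suc h + suc h)) ≡ swap (tick (suc h) (n % (suc h + suc h)))
tick-half h n = by-cases (n % p ≟ⁿ 0) (n % p ≟ⁿ w)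
  where
  w p : ℕ
  w = suc h
  p = w + w
  w<p : w < p
  w<p = m<m+n w z<s
  half : ∀ n {r} → n % p ≡ r → (n + w) % p ≡ (r + w) % p
  half n refl = %-half w n w<p
  twice : ∀ {r} → (n + w) % p ≡ r → n % p ≡ (r + w) % p
  twice e = trans (sym ([m+n]%n≡m%n n p)) (trans (cong (_% p) (sym (+-assoc n w w))) (half (n + w) e))
  by-cases : Dec (n % p ≡ 0) → Dec (n % p ≡ w) → tick w ((n + w) % p) ≡ swap (tick w (n % p))
  by-cases (yes r≡0) _ = trans (cong (tick w) (trans (half n r≡0) (m<n⇒m%n≡m w<p)))
    (trans (tick-w h) (cong (swap ∘ tick w) (sym r≡0)))
  by-cases (no _) (yes r≡w) = trans (cong (tick w) (trans (half n r≡w) (n%n≡0 p)))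
    (cong swap (trans (sym (tick-w h)) (cong (tick w) (sym r≡w))))
  by-cases (no r≢0) (no r≢w) = trans
    (tick-∅ w _ (λ r′≡0 → r≢w (trans (twice r′≡0) (m<n⇒m%n≡m w<p))) (λ r′≡w → r≢0 (trans (twice r′≡w) (n%n≡0 p))))
    (cong swap (sym (tick-∅ w _ r≢0 r≢w)))

instr : ℕ → List Op → Op
instr _       []       = nop
instr zero    (o ∷ _)  = o
instr (suc j) (_ ∷ os) = instr j os

abstract

  clock : ℕ → ℕ → Kind
  clock h n = tick (suc h) (n % (suc h + suc h))

  clock-period : ∀ h n → clock h (n + (suc h + suc h)) ≡ clock h n
  clock-period h n = cong (tick (suc h)) ([m+n]%n≡m%n n (suc h + suc h))

  clock-multiple : ∀ h j → clock h (j * (suc h + suc h)) ≡ ●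
  clock-multiple h j = cong (tick (suc h)) (m*n%n≡0 j (suc h + suc h))

  clock-● : ∀ h t → clock h t ≡ ● → ∃ λ j → t ≡ j * (suc h + suc h)
  clock-● h t e = t / p , trans (m≡m%n+[m/n]*n t p) (cong (_+ t / p * p) (tick-● (suc h) _ e))
    where
    p : ℕ
    p = suc h + suc h

  clock-apart : ∀ h n d → suc d < suc h + suc h → clash (clock h n) (clock h (n + suc d)) ≡ false
  clock-apart h n d d< with clock h n in e | clock h (n + suc d) in e′
  ... | ∅ | _ = refl
  ... | ● | ∅ = refl
  ... | ● | ○ = refl
  ... | ○ | ∅ = refl
  ... | ○ | ● = refl
  ... | ● | ● with m+n≡m-mod n (suc d) (suc h + suc h) d< (trans (tick-● (suc h) _ e′) (sym (tick-● (suc h) _ e)))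
  ...   | ()
  clock-apart h n d d< | ○ | ○
    with m+n≡m-mod n (suc d) (suc h + suc h) d< (trans (tick-○ (suc h) _ e′) (sym (tick-○ (suc h) _ e)))
  ...   | ()

  clock-half : ∀ h n → clock h (n + suc h) ≡ swap (clock h n)
  clock-half = tick-half

  clock-half-shift : ∀ h n → clock h n ≡ clock h (n + suc h + suc h)
  clock-half-shift h n = trans (sym (clock-period h n)) (cong (clock h) (sym (+-assoc n (suc h) (suc h))))

  -- In a loop of even length h the token meets the operations with even index only.
  schedule : (h : ℕ) .{{_ : NonZero h}} → List Op → ℕ → Op
  schedule h os n = instr ((n % h) / 2) os

  schedule-period : ∀ h .{{_ : NonZero h}} os n → schedule h os (n + h) ≡ schedule h os n
  schedule-period h os n = cong (λ r → instr (r / 2) os) ([m+n]%n≡m%n n h)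

  -- For `h = W + W` the token period is `2 * h + 2`, so the `j`-th return of the ping falls on the
  -- residue `2 * j` modulo `h`.
  schedule-multiple : ∀ W .{{_ : NonZero (W + W)}} os j → j < W →
    schedule (W + W) os (j * (suc (W + W) + suc (W + W))) ≡ instr j os
  schedule-multiple W os j j<W = cong (λ i → instr i os) (trans (cong (_/ 2) (trans (cong (_% (W + W)) (split j W))
    (trans ([m+kn]%n≡m%n (j * 2) (j * 2) (W + W)) (m<n⇒m%n≡m small)))) (m*n/n≡m j 2))
    where
    split : ∀ j W → j * (suc (W + W) + suc (W + W)) ≡ j * 2 + j * 2 * (W + W)
    split = solve-∀
    double : ∀ j → j + j ≡ j * 2
    double = solve-∀
    small : j * 2 < W + W
    small = subst (_< W + W) (double j) (+-mono-< j<W j<W)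

clock-Clock : ∀ h .{{_ : NonZero h}} os → Clock h (clock h) (schedule h os)
clock-Clock h os = record
  { c-period = clock-period h
  ; c-apart  = clock-apart h
  ; x-period = schedule-period h os }

clock-Clock′ : ∀ h .{{_ : NonZero h}} os → Clock h (λ n → clock h (n + suc h)) (schedule h os)
clock-Clock′ h os = record
  { c-period = λ n → trans (cong (clock h) (swap-last n (suc h + suc h) (suc h))) (clock-period h (n + suc h))
  ; c-apart  = λ n d d< → trans (cong (λ m → clash (clock h (n + suc h)) (clock h m)) (swap-last n (suc d) (suc h)))
                 (clock-apart h (n + suc h) d d<)
  ; x-period = schedule-period h os }
  where
  swap-last : ∀ n a b → n + a + b ≡ n + b + a
  swap-last = solve-∀

badOf : Cell → Bool
badOf (mk _ _ b _ _) = b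
badOf _              = false

inboxOf : Cell → Message
inboxOf (mk _ _ _ m _) = m
inboxOf _              = nothing

regsOf : Cell → Reg
regsOf (mk _ _ _ _ s) = s
regsOf _              = ⟨ false , false , false , false , nothing ⟩

match-sound : ∀ l r → match l r ≡ true → IsMid l × IsMid r × outK l ≡ swap (inK r) × outO l ≡ inO r
match-sound (mid o _ p _) (mid _ i _ q) e with o ≟ᵏ swap i | p ≟ᵒ q
match-sound (mid o _ p _) (mid _ i _ q) e  | yes e₁ | yes e₂ = refl , refl , e₁ , e₂
match-sound (mid o _ p _) (mid _ i _ q) () | yes _  | no _
match-sound (mid o _ p _) (mid _ i _ q) () | no _   | _

match-complete : ∀ l r → IsMid l → IsMid r → outK l ≡ swap (inK r) → outO l ≡ inO r → match l r ≡ true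
match-complete (mid o _ p _) (mid _ i _ q) _ _ e₁ e₂ rewrite dec-true (o ≟ᵏ swap i) e₁ | dec-true (p ≟ᵒ q) e₂ = refl

swap-swap : ∀ a → swap (swap a) ≡ a
swap-swap ∅ = refl
swap-swap ● = refl
swap-swap ○ = refl

arriveLeft-mid : ∀ c → IsMid (shape c) → arriveLeft c ≡ tokLeft c
arriveLeft-mid (mid _ _ _ _) _ = refl

arriveRight-mid : ∀ c → IsMid (shape c) → arriveRight c ≡ tokRight c
arriveRight-mid (mid _ _ _ _) _ = refl

arriveOp-mid : ∀ c → IsMid (shape c) → arriveOp c ≡ inO (shape c)
arriveOp-mid (mid _ _ _ _) _ = refl

step-mid-tokens : ∀ l c r → IsMid (shape (step l c r)) →
  tokRight (step l c r) ≡ tokRight l × tokLeft (step l c r) ≡ tokLeft r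
step-mid-tokens l (mid _ _ _ _) r m
  with alive (shape l) ∧ alive (shape r) ∧ not (clash (outK (shape l)) (inK (shape r)))
step-mid-tokens l (mid _ _ _ _) r m  | true = refl , refl
step-mid-tokens l (mid _ _ _ _) r () | false

step-mk : ∀ l c r → IsMk (shape c) → let s′ = execOn (arriveLeft r) (arriveOp r) (mask (badOf c) (inboxOf c)) (regsOf c) in
  step l c r ≡ mk (emit (arriveLeft r) (msg s′)) (emit (arriveRight l) (mask (badOf c) (msg (regsOf c))))
    (newBad (match (shape l) (shape r)) (kind (arriveLeft r)) (arriveOp r) (badOf c))
    (receive (arriveRight l) (inboxOf c)) s′
step-mk l (mk _ _ _ _ _) r _ = refl

execOn-idle : ∀ t o l s → kind t ≢ ● → execOn t o l s ≡ s
execOn-idle empty    o l s _ = refl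
execOn-idle pong     o l s _ = refl
execOn-idle (ping _) o l s n = ⊥-elim (n refl)

receive-idle : ∀ t m → kind t ≢ ● → receive t m ≡ m
receive-idle empty    m _ = refl
receive-idle pong     m _ = refl
receive-idle (ping _) m n = ⊥-elim (n refl)

payload : ∀ t → kind t ≡ ● → ∃ λ m → t ≡ ping m
payload (ping m) _ = m , refl

instr-ordinary : ∀ {os} → All (λ o → isInit o ≡ false) os → ∀ j → isInit (instr j os) ≡ false
instr-ordinary []       j       = refl
instr-ordinary (p ∷ ps) zero    = p
instr-ordinary (p ∷ ps) (suc j) = instr-ordinary ps j

rowRight rowLeft : (ℤ → Cell) → ℤ → ℕ → Shape
rowRight x z y = shape (x (z ℤ.+ + y))
rowLeft  x z y = mirror (shape (x (z ℤ.- + y)))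

-- Recognizing the neighbours

module Run
  (X : ℕ → ℤ → Cell)
  (X-step : ∀ t z → X (suc t) z ≡ step (X t (z ℤ.+ ℤ.-1ℤ)) (X t z) (X t (z ℤ.+ ℤ.1ℤ)))
  (rest : List Op) (ordinary : All (λ o → isInit o ≡ false) rest)
  where

  os : List Op
  os = init ∷ rest

  -- The choice of `κ` makes `h` equal to both `suc κ` and `W + W` by computation. `T` is the
  -- duration of one pass through the program.
  W κ h w p T : ℕ
  W = length os
  κ = length rest + W
  h = suc κ
  w = suc h
  p = w + w
  T = W * p

  c c′ : ℕ → Kind
  c = clock h
  c′ n = clock h (n + w)

  x : ℕ → Op
  x = schedule h os

  C : Clock h c x
  C = clock-Clock h os

  C′ : Clock h c′ x
  C′ = clock-Clock′ h os

  GoodR GoodL : ℕ → ℤ → Set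
  GoodR t z = Good h c x t (rowRight (X t) z)
  GoodL t z = Good h c′ x t (rowLeft (X t) z)

  X-step′ : ∀ t {l z r} → z ℤ.+ ℤ.-1ℤ ≡ l → z ℤ.+ ℤ.1ℤ ≡ r → X (suc t) z ≡ step (X t l) (X t z) (X t r)
  X-step′ t refl refl = X-step t _

  shape-X-step : ∀ t {l z r} → z ℤ.+ ℤ.-1ℤ ≡ l → z ℤ.+ ℤ.1ℤ ≡ r →
    shape (X (suc t) z) ≡ stepShape (shape (X t l)) (shape (X t z)) (shape (X t r))
  shape-X-step t {l} {z} {r} e e′ = trans (cong shape (X-step′ t e e′)) (shape-step (X t l) (X t z) (X t r))

  right-pred : ∀ z y → z ℤ.+ + suc y ℤ.+ ℤ.-1ℤ ≡ z ℤ.+ + y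
  right-pred z y = lem z (+ y)
    where
    lem : ∀ z y → z ℤ.+ (ℤ.1ℤ ℤ.+ y) ℤ.+ ℤ.-1ℤ ≡ z ℤ.+ y
    lem = ℤˢ.solve-∀

  right-suc : ∀ z y → z ℤ.+ + y ℤ.+ ℤ.1ℤ ≡ z ℤ.+ + suc y
  right-suc z y = lem z (+ y)
    where
    lem : ∀ z y → z ℤ.+ y ℤ.+ ℤ.1ℤ ≡ z ℤ.+ (ℤ.1ℤ ℤ.+ y)
    lem = ℤˢ.solve-∀

  left-pred : ∀ z y → z ℤ.- + suc y ℤ.+ ℤ.1ℤ ≡ z ℤ.- + y
  left-pred z y = lem z (+ y)
    where
    lem : ∀ z y → z ℤ.- (ℤ.1ℤ ℤ.+ y) ℤ.+ ℤ.1ℤ ≡ z ℤ.- y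
    lem = ℤˢ.solve-∀

  left-suc : ∀ z y → z ℤ.- + y ℤ.+ ℤ.-1ℤ ≡ z ℤ.- + suc y
  left-suc z y = lem z (+ y)
    where
    lem : ∀ z y → z ℤ.- y ℤ.+ ℤ.-1ℤ ≡ z ℤ.- (ℤ.1ℤ ℤ.+ y)
    lem = ℤˢ.solve-∀

  module VR (z : ℤ) = View (λ t y → rowRight (X t) z y) (λ t → shape (X t (z ℤ.+ ℤ.0ℤ ℤ.+ ℤ.-1ℤ)))
    (λ t → shape-X-step t refl (right-suc z 0)) (λ t y → shape-X-step t (right-pred z y) (right-suc z (suc y))) κ

  module VL (z : ℤ) = View (λ t y → rowLeft (X t) z y) (λ t → mirror (shape (X t (z ℤ.- ℤ.0ℤ ℤ.+ ℤ.1ℤ))))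
    (λ t → trans (cong mirror (shape-X-step t (left-suc z 0) refl))
      (mirror-step (shape (X t (z ℤ.- + 1))) (shape (X t (z ℤ.- + 0))) (shape (X t (z ℤ.- + 0 ℤ.+ ℤ.1ℤ)))))
    (λ t y → trans (cong mirror (shape-X-step t (left-suc z (suc y)) (left-pred z y)))
      (mirror-step (shape (X t (z ℤ.- + suc (suc y)))) (shape (X t (z ℤ.- + suc y))) (shape (X t (z ℤ.- + y))))) κ

  right⇒left : ∀ t z z′ → z ℤ.+ + w ≡ z′ → GoodR t z → GoodL t z′
  right⇒left t z z′ e = good-mirror
    (λ y y′ e′ → cong (λ i → mirror (shape (X t i)))
        (trans (cong (ℤ._- + y′) (trans (sym e) (cong (λ n → z ℤ.+ + n) (sym e′)))) (lem z (+ y) (+ y′))))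
    (λ _ → refl) (clock-half-shift h)
    where
    lem : ∀ z y y′ → z ℤ.+ (y ℤ.+ y′) ℤ.- y′ ≡ z ℤ.+ y
    lem = ℤˢ.solve-∀

  left⇒right : ∀ t z z′ → z ℤ.+ + w ≡ z′ → GoodL t z′ → GoodR t z
  left⇒right t z z′ e = good-mirror
    (λ y y′ e′ → trans (cong (shape ∘ X t) (trans (lem z (+ y) (+ y′))
        (cong (ℤ._- + y) (trans (cong (λ n → z ℤ.+ + n) e′) e)))) (sym (mirror-mirror _)))
    (clock-half-shift h) (λ _ → refl)
    where
    lem : ∀ z y y′ → z ℤ.+ y′ ≡ z ℤ.+ (y ℤ.+ y′) ℤ.- y
    lem = ℤˢ.solve-∀

  goodR-all : ∀ {z} → GoodR 0 z → ∀ t → GoodR t z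
  goodR-all {z} G t = subst (λ i → GoodR i z) (+-identityʳ t) (VR.good-forth z C t 0 G)

  goodL-all : ∀ {z} → GoodL 0 z → ∀ t → GoodL t z
  goodL-all {z} G t = subst (λ i → GoodL i z) (+-identityʳ t) (VL.good-forth z C′ t 0 G)

  c-● : ∀ j → c (j * p) ≡ ●
  c-● = clock-multiple h

  c-swap : ∀ t → c′ t ≡ swap (c t)
  c-swap = clock-half h

  x-at : ∀ j → j < W → x (j * p) ≡ instr j os
  x-at = schedule-multiple W os

  fires : ℕ → Bool
  fires t = isPing (c t) ∧ isInit (x t)

  fires-0 : fires 0 ≡ true
  fires-0 = cong₂ (λ κ o → isPing κ ∧ isInit o) (c-● 0) (x-at 0 z<s)

  -- The ping comes home at multiples of `p` only, and within one pass only its arrival at time 0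
  -- meets the head of the program.
  fires-suc : ∀ t → suc t < T → fires (suc t) ≡ false
  fires-suc t t< with c (suc t) in e
  ... | ∅ = refl
  ... | ○ = refl
  ... | ● with clock-● h (suc t) e
  ... | suc j , e′ = trans (cong isInit (trans (cong x e′) (x-at (suc j) j<W))) (instr-ordinary ordinary j)
    where
    j<W : suc j < W
    j<W = *-cancelʳ-< p (suc j) W (subst (_< T) e′ t<)

  module Flag (z : ℤ) (marker : IsMk (shape (X 0 z))) where

    lft rgt : ℕ → Shape
    lft t = shape (X t (z ℤ.+ ℤ.-1ℤ))
    rgt t = shape (X t (z ℤ.+ ℤ.1ℤ))

    matched : ℕ → Bool
    matched t = match (lft t) (rgt t)

    bad : ℕ → Bool
    bad t = badOf (X t z)

    -- At least one of the two neighbouring blocks is genuine, so a match determines the right stream.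
    Known : Set
    Known = ∀ t → matched t ≡ true → inK (rgt t) ≡ c t × inO (rgt t) ≡ x t

    marker-at : ∀ t → IsMk (shape (X t z))
    marker-at zero    = marker
    marker-at (suc t) = trans (cong type (shape-X-step t refl refl)) (mk-static _ _ _ (marker-at t))

    bad-suc : Known → ∀ t → bad (suc t) ≡ (if matched t then not (fires t) ∧ bad t else true)
    bad-suc K t = trans (cong badOf (trans (X-step t z) (step-mk _ _ _ (marker-at t)))) (go (matched t) refl)
      where
      r = X t (z ℤ.+ ℤ.1ℤ)
      go : ∀ m → matched t ≡ m → newBad m (kind (arriveLeft r)) (arriveOp r) (bad t) ≡
          (if m then not (fires t) ∧ bad t else true)
      go false _ = refl
      go true  e = cong₂ (λ κ o → not (isPing κ ∧ isInit o) ∧ bad t)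
        (trans (cong kind (arriveLeft-mid r mid-r)) (trans (kind-tokLeft r) (proj₁ (K t e))))
        (trans (arriveOp-mid r mid-r) (proj₂ (K t e)))
        where
        mid-r : IsMid (shape r)
        mid-r = proj₁ (proj₂ (match-sound (lft t) (rgt t) e))

    -- After time 0 no `init` fires before `T`, and at time 0 a mismatch overrides it. Hence a
    -- mismatch would still be on record at time `suc n`.
    all-matched : Known → ∀ n → suc n ≤ T → bad (suc n) ≡ false → ∀ t → t ≤ n → matched t ≡ true
    all-matched K n n≤ e t t≤n with matched n in em | bad-suc K n
    ... | false | e′ = contradiction (trans (sym e′) e) λ ()
    ... | true  | e′ with m≤n⇒m<n∨m≡n t≤n
    ...   | inj₂ refl = em
    all-matched K (suc n) n≤ e t t≤n | true | e′ | inj₁ (s≤s t<n) = all-matched K n (<⇒≤ n≤)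
      (trans (cong (λ f → not f ∧ bad (suc n)) (sym (fires-suc n n≤))) (trans (sym e′) e)) t t<n

    never-bad : Known → (∀ t → matched t ≡ true) → ∀ n → suc n ≤ T → bad (suc n) ≡ false
    -- The `init` at time 0 erases whatever flag the initial configuration happens to contain.
    never-bad K M zero    n≤ = trans (bad-suc K 0)
        (trans (cong (λ m → if m then not (fires 0) ∧ bad 0 else true) (M 0)) (cong (λ f → not f ∧ bad 0) fires-0))
    never-bad K M (suc n) n≤ = trans (bad-suc K (suc n))
        (trans (cong (λ m → if m then not (fires (suc n)) ∧ bad (suc n) else true) (M (suc n)))
      (trans (cong (λ f → not f ∧ bad (suc n)) (fires-suc n n≤)) (never-bad K M n (<⇒≤ n≤))))

    module _ (t : ℕ) where
      right-arrivals : GoodR t z → IsMid (rgt t) × inK (rgt t) ≡ c t × inO (rgt t) ≡ x t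
      right-arrivals G = mids 0 z<s , trans (inK≡ 0 z≤n) (cong c (+-identityʳ t)) , trans (inO≡ 0 z<s)
          (cong x (+-identityʳ t))
        where open Good G

      left-arrivals : GoodL t z → IsMid (lft t) × outK (lft t) ≡ swap (c t) × outO (lft t) ≡ x t
      left-arrivals G = trans (sym (type-mirror (lft t))) (mids 0 z<s)
        , trans (sym (in-mirror (lft t))) (trans (inK≡ 0 z≤n) (trans (cong c′ (+-identityʳ t)) (c-swap t)))
        , trans (sym (inO-mirror (lft t))) (trans (inO≡ 0 z<s) (cong x (+-identityʳ t)))
        where
        open Good G

    known-right : GoodR 0 z → Known
    known-right G t _ = proj₂ (right-arrivals t (goodR-all {z} G t))

    known-left : GoodL 0 z → Known
    known-left G t e = trans (sym (swap-swap (inK (rgt t))))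
        (trans (cong swap (trans (sym e₁) (proj₁ (proj₂ L)))) (swap-swap (c t)))
      , trans (sym e₂) (proj₂ (proj₂ L))
      where
      L = left-arrivals t (goodL-all {z} G t)
      M = match-sound (lft t) (rgt t) e
      e₁ = proj₁ (proj₂ (proj₂ M))
      e₂ = proj₂ (proj₂ (proj₂ M))

    -- By then the flag covers all arrivals up to time `p + p`, as `good-exact` demands, and the
    -- next `init` has not yet cleared it.
    late : ℕ → Set
    late n = p + p < n × n ≤ T

    both-good : GoodR 0 z → GoodL 0 z → ∀ n → late n → bad n ≡ false
    both-good GR GL (suc n) (_ , n≤) = never-bad (known-right GR)
      (λ t → let R = right-arrivals t (goodR-all {z} GR t) ; L = left-arrivals t (goodL-all {z} GL t) in
        match-complete (lft t) (rgt t) (proj₁ L) (proj₁ R)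
          (trans (proj₁ (proj₂ L)) (cong swap (sym (proj₁ (proj₂ R)))))
          (trans (proj₂ (proj₂ L)) (sym (proj₂ (proj₂ R))))) n n≤

    -- Matches transfer the clock of the genuine left block to the arrivals from the right. The flag
    -- thus certifies one neighbour on the authority of the other.
    right-good : GoodL 0 z → ∀ n → late n → bad n ≡ false → GoodR 0 z
    right-good GL (suc n) (s≤s 2p≤n , n≤) e = VR.good-exact z C ● refl (c-● 0)
      (subst (λ i → IsMk (shape (X 0 i))) (sym (ℤₚ.+-identityʳ z)) marker)
      (λ t t≤ → let m = all-matched (known-left GL) n n≤ e t (≤-trans t≤ 2p≤n) in
        proj₁ (proj₂ (match-sound (lft t) (rgt t) m)) , known-left GL t m)

    left-good : GoodR 0 z → ∀ n → late n → bad n ≡ false → GoodL 0 z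
    left-good GR (suc n) (s≤s 2p≤n , n≤) e = VL.good-exact z C′ ○ refl (trans (c-swap 0) (cong swap (c-● 0)))
      (trans (type-mirror _) (subst (λ i → IsMk (shape (X 0 i))) (sym (ℤₚ.+-identityʳ z)) marker))
      (λ t t≤ → let m = all-matched (known-right GR) n n≤ e t (≤-trans t≤ 2p≤n)
                    R = known-right GR t m
                    M = match-sound (lft t) (rgt t) m
                in
        trans (type-mirror (lft t)) (proj₁ M)
        , trans (in-mirror (lft t)) (trans (proj₁ (proj₂ (proj₂ M))) (trans (cong swap (proj₁ R)) (sym (c-swap t))))
        , trans (inO-mirror (lft t)) (trans (proj₂ (proj₂ (proj₂ M))) (proj₂ R)))

-- Blocks as parallel register machines

vis : (ℤ → Bool) → (ℤ → Reg) → ℤ → Message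
vis v s i = if v i then msg (s i) else nothing

parallel : (ℤ → Bool) → Op → (ℤ → Reg) → ℤ → Reg
parallel v o s i = exec o (vis v s (i ℤ.+ ℤ.-1ℤ)) (s i) (vis v s (i ℤ.+ ℤ.1ℤ))

runOps : (ℤ → Bool) → List Op → (ℤ → Reg) → ℤ → Reg
runOps v []       s = s
runOps v (o ∷ os) s = runOps v os (parallel v o s)

-- Only `mark` and `bit` encode data; the other registers are working storage and may initially hold
-- anything.
content : Bool → Reg → Message
content v s = if v then just (mark s , bit s) else nothing

emit-ping : ∀ t m → kind t ≡ ● → emit t m ≡ ping m
emit-ping (ping _) m _ = refl

period-multiple : ∀ {A : Set} (f : ℕ → A) p → (∀ n → f (n + p) ≡ f n) → ∀ m n → f (m * p + n) ≡ f n
period-multiple f p e zero    n = refl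
period-multiple f p e (suc m) n = trans (cong f (lem p (m * p) n)) (trans (e (m * p + n)) (period-multiple f p e m n))
  where
  lem : ∀ p q n → p + q + n ≡ q + n + p
  lem = solve-∀

module Simulation
  (X : ℕ → ℤ → Cell)
  (X-step : ∀ t z → X (suc t) z ≡ step (X t (z ℤ.+ ℤ.-1ℤ)) (X t z) (X t (z ℤ.+ ℤ.1ℤ)))
  (prog : List Op) (ordinary : All (λ o → isInit o ≡ false) prog)
  where

  -- The two initial `nop`s leave the markers the 4w steps they need to recognize their neighbours.
  open Run X X-step (nop ∷ nop ∷ prog) (refl ∷ refl ∷ ordinary)

  regs : ℕ → ℤ → Reg
  regs t z = regsOf (X t z)

  inbox : ℕ → ℤ → Message
  inbox t z = inboxOf (X t z)

  bad : ℕ → ℤ → Bool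
  bad t z = badOf (X t z)

  fromL fromR : ℕ → ℤ → Token
  fromL t z = arriveRight (X t (z ℤ.+ ℤ.-1ℤ))
  fromR t z = arriveLeft (X t (z ℤ.+ ℤ.1ℤ))

  markerR : ∀ {z} → GoodR 0 z → IsMk (shape (X 0 z))
  markerR {z} G = subst (λ i → IsMk (shape (X 0 i))) (ℤₚ.+-identityʳ z) (Good.start G)

  markerL : ∀ {z} → GoodL 0 z → IsMk (shape (X 0 z))
  markerL {z} G = subst (λ i → IsMk (shape (X 0 i))) (ℤₚ.+-identityʳ z) (trans (sym (type-mirror _)) (Good.start G))

  module _ {z : ℤ} (M : IsMk (shape (X 0 z))) (t : ℕ) where

    private
      l r : Cell
      l = X t (z ℤ.+ ℤ.-1ℤ)
      r = X t (z ℤ.+ ℤ.1ℤ)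
      stepped = trans (X-step t z) (step-mk l (X t z) r (Flag.marker-at z M t))

    regs-suc : regs (suc t) z ≡ execOn (fromR t z) (arriveOp r) (mask (bad t z) (inbox t z)) (regs t z)
    regs-suc = cong regsOf stepped

    inbox-suc : inbox (suc t) z ≡ receive (fromL t z) (inbox t z)
    inbox-suc = cong inboxOf stepped

    tokRight-suc : tokRight (X (suc t) z) ≡ emit (fromR t z) (msg (regs (suc t) z))
    tokRight-suc = trans (cong tokRight stepped) (cong (λ s → emit (fromR t z) (msg s)) (sym regs-suc))

    tokLeft-suc : tokLeft (X (suc t) z) ≡ emit (fromL t z) (mask (bad t z) (msg (regs t z)))
    tokLeft-suc = cong tokLeft stepped

  kind-fromR : ∀ {z} → GoodR 0 z → ∀ t → kind (fromR t z) ≡ c t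
  kind-fromR {z} G t = trans (cong kind (arriveLeft-mid (X t (z ℤ.+ ℤ.1ℤ)) (proj₁ R)))
      (trans (kind-tokLeft (X t (z ℤ.+ ℤ.1ℤ))) (proj₁ (proj₂ R)))
    where R = Flag.right-arrivals z (markerR {z} G) t (goodR-all {z} G t)

  kind-fromL : ∀ {z} → GoodL 0 z → ∀ t → kind (fromL t z) ≡ c′ t
  kind-fromL {z} G t = trans (cong kind (arriveRight-mid (X t (z ℤ.+ ℤ.-1ℤ)) (proj₁ L)))
    (trans (kind-tokRight (X t (z ℤ.+ ℤ.-1ℤ))) (trans (proj₁ (proj₂ L)) (sym (c-swap t))))
    where L = Flag.left-arrivals z (markerL {z} G) t (goodL-all {z} G t)

  right-ray : ∀ {z} → GoodR 0 z → ∀ u t → u ≤ h → tokRight (X (u + t) (z ℤ.+ + u)) ≡ tokRight (X t z)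
  right-ray {z} G zero    t _   = cong (λ i → tokRight (X t i)) (ℤₚ.+-identityʳ z)
  right-ray {z} G (suc u) t u<h = trans
    (trans (cong tokRight stepped) (proj₁ (step-mid-tokens
      (X (u + t) (z ℤ.+ + u)) (X (u + t) (z ℤ.+ + suc u)) (X (u + t) (z ℤ.+ + suc (suc u)))
      (trans (cong (type ∘ shape) (sym stepped)) (Good.mids (goodR-all {z} G (suc u + t)) u u<h)))))
    (right-ray {z} G u t (<⇒≤ u<h))
    where stepped = X-step′ (u + t) (right-pred z u) (right-suc z (suc u))

  left-ray : ∀ {z} → GoodR 0 z → ∀ u v t → u + v ≡ h → tokLeft (X (u + t) (z ℤ.+ + suc v)) ≡ tokLeft (X t (z ℤ.+ + w))
  left-ray {z} G zero    v t refl = refl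
  left-ray {z} G (suc u) v t e = trans
    (trans (cong tokLeft stepped) (proj₂ (step-mid-tokens
      (X (u + t) (z ℤ.+ + v)) (X (u + t) (z ℤ.+ + suc v)) (X (u + t) (z ℤ.+ + suc (suc v)))
      (trans (cong (type ∘ shape) (sym stepped)) (Good.mids (goodR-all {z} G (suc u + t)) v v<h)))))
    (left-ray {z} G u (suc v) t (trans (+-suc u v) e))
    where
    stepped = X-step′ (u + t) (right-pred z v) (right-suc z (suc v))
    v<h : v < h
    v<h = ≤-trans (s≤s (m≤n+m v u)) (≤-reflexive e)

  c-idle : ∀ j d → suc d < p → c (suc d + j * p) ≢ ●
  c-idle j d d< e with trans (sym (Clock.c-apart C (j * p) d d<)) (cong₂ clash (c-● j) (trans (cong c (+-comm (j * p) (suc d))) e))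
  ... | ()

  regs-const : ∀ {z} → GoodR 0 z → ∀ j d → d < p → regs (d + suc (j * p)) z ≡ regs (suc (j * p)) z
  regs-const {z}     G j zero    _  = refl
  regs-const {z} G j (suc d) d< = trans (regs-suc (markerR {z} G) t) (trans (execOn-idle (fromR t z) _ _ _
      (λ e → c-idle j d d< (trans (cong c (sym (+-suc d (j * p)))) (trans (sym (kind-fromR {z} G t)) e))))
    (regs-const {z} G j d (<⇒≤ d<)))
    where
    t : ℕ
    t = d + suc (j * p)

  -- The registers before the j-th operation of the program.
  ρ : ℕ → ℤ → Reg
  ρ j z = regs (j * p) z

  ρ-suc : ∀ {z} → GoodR 0 z → ∀ j → regs (suc (j * p)) z ≡ ρ (suc j) z
  ρ-suc {z} G j = trans (sym (regs-const {z} G j (h + w) ≤-refl)) (cong (λ t → regs t z) (+-suc (h + w) (j * p)))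

  ρ-exec : ∀ {z} → GoodR 0 z → ∀ j → j < W → ∀ m → fromR (j * p) z ≡ ping m →
    ρ (suc j) z ≡ exec (instr j os) (mask (bad (j * p) z) (inbox (j * p) z)) (ρ j z) m
  ρ-exec {z} G j j<W m e = trans (sym (ρ-suc {z} G j)) (trans (regs-suc (markerR {z} G) (j * p))
    (trans (cong (λ t → execOn t o l s) e) (cong (λ o → exec o l s m)
      (trans (arriveOp-mid _ (proj₁ R)) (trans (proj₂ (proj₂ R)) (x-at j j<W))))))
    where
    R = Flag.right-arrivals z (markerR {z} G) (j * p) (goodR-all {z} G (j * p))
    o = arriveOp (X (j * p) (z ℤ.+ ℤ.1ℤ))
    l = mask (bad (j * p) z) (inbox (j * p) z)
    s = ρ j z

  ping-at : ∀ {z} → GoodR 0 z → ∀ j → ∃ λ m → fromR (j * p) z ≡ ping m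
  ping-at {z} G j = payload _ (trans (kind-fromR {z} G (j * p)) (c-● j))

  -- The ping sent out after operation `j` reaches the next marker at half time, and no other ping
  -- overwrites the inbox before operation `suc j`.
  inbox-from-left : ∀ {zl z} → zl ℤ.+ + w ≡ z → GoodR 0 zl → ∀ j → inbox (suc j * p) z ≡ msg (ρ (suc j) zl)
  inbox-from-left {zl} {z} e G j = trans (cong (λ t → inbox t z) (sym (lem₁ h (j * p))))
    (trans (const h (s≤s (m≤m+n h w))) (trans (inbox-suc (markerL {z} GL) t*)
        (cong (λ t → receive t (inbox t* z)) received)))
    where
    t* : ℕ
    t* = h + suc (j * p)
    lem₁ : ∀ h q → h + suc (h + suc q) ≡ suc h + suc h + q
    lem₁ = solve-∀
    GL : GoodL 0 z
    GL = right⇒left 0 zl z e G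
    at : zl ℤ.+ + h ≡ z ℤ.+ ℤ.-1ℤ
    at = trans (sym (right-pred zl h)) (cong (ℤ._+ ℤ.-1ℤ) e)
    received : fromL t* z ≡ ping (msg (ρ (suc j) zl))
    received = trans (arriveRight-mid _ (proj₁ (Flag.left-arrivals z (markerL {z} GL) t* (goodL-all {z} GL t*))))
      (trans (cong (λ i → tokRight (X t* i)) (sym at)) (trans (right-ray {zl} G h (suc (j * p)) ≤-refl)
        (trans (tokRight-suc (markerR {zl} G) (j * p)) (trans (emit-ping _ _ (trans (kind-fromR {zl} G (j * p)) (c-● j)))
          (cong (ping ∘ msg) (ρ-suc {zl} G j))))))
    const : ∀ d → d < p → inbox (d + suc t*) z ≡ inbox (suc t*) z
    const zero    _  = refl
    const (suc d) d< = trans (inbox-suc (markerL {z} GL) (d + suc t*)) (trans (receive-idle _ _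
        (λ e → c-idle (suc j) d d< (trans (cong c (lem₂ d h (j * p))) (trans (sym (kind-fromL {z} GL (d + suc t*))) e))))
      (const d (<⇒≤ d<)))
      where
      lem₂ : ∀ d h q → suc d + (suc h + suc h + q) ≡ d + suc (h + suc q) + suc h
      lem₂ = solve-∀

  -- The right marker reflects the ping at time `t*` and loads it with its own message for the way
  -- back.
  payload-from-right : ∀ {z zr} → z ℤ.+ + w ≡ zr → GoodR 0 z → ∀ j →
    let t* = h + suc (j * p) in fromR (suc j * p) z ≡ ping (mask (bad t* zr) (msg (regs t* zr)))
  payload-from-right {z} refl G j = trans (arriveLeft-mid _
      (proj₁ (Flag.right-arrivals z (markerR {z} G) _ (goodR-all {z} G _))))
    (trans (cong (λ t → tokLeft (X t (z ℤ.+ + 1))) (sym (lem₁ h (j * p))))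
      (trans (left-ray {z} G h 0 (suc t*) (+-identityʳ h))
        (trans (tokLeft-suc (markerL {z ℤ.+ + w} GL) t*)
            (emit-ping _ _ (trans (kind-fromL {z ℤ.+ + w} GL t*) (trans (cong c (lem₂ h (j * p))) (c-● (suc j))))))))
    where
    t* : ℕ
    t* = h + suc (j * p)
    GL : GoodL 0 (z ℤ.+ + w)
    GL = right⇒left 0 z _ refl G
    lem₁ : ∀ h q → h + suc (h + suc q) ≡ suc h + suc h + q
    lem₁ = solve-∀
    lem₂ : ∀ h q → h + suc q + suc h ≡ suc h + suc h + q
    lem₂ = solve-∀

  good-at? : ∀ z → Dec (GoodR 0 z)
  good-at? z = good? h c x 0 (rowRight (X 0) z)

  visible : ℕ → ℤ → Message
  visible j z = if does (good-at? z) then msg (ρ j z) else nothing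

  -- Since the block to the right of `z` is genuine, the flag at `z` tells whether the one to its
  -- left is genuine too. The bounds on `j` place the reading in the interval where the flag is
  -- reliable.
  from-left : ∀ {zl z} → zl ℤ.+ + w ≡ z → GoodR 0 z → ∀ j → 2 ≤ j → suc j ≤ W →
    mask (bad (suc j * p) z) (inbox (suc j * p) z) ≡ visible (suc j) zl
  from-left {zl} {z} e G j 2≤j j≤ = by-cases (good-at? zl)
    where
    late : Flag.late z (markerR {z} G) (suc j * p)
    late = <-≤-trans (+-monoʳ-< p (m<m+n p z<s)) (≤-trans (≤-reflexive (lem p)) (*-monoˡ-≤ p (s≤s 2≤j)))
      , *-monoˡ-≤ p j≤
      where
      lem : ∀ p → p + (p + p) ≡ 3 * p
      lem = solve-∀
    by-cases : ∀ d → mask (bad (suc j * p) z) (inbox (suc j * p) z) ≡ (if does d then msg (ρ (suc j) zl) else nothing)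
    by-cases (yes Gl) = trans
      (cong (λ b → mask b (inbox (suc j * p) z))
        (Flag.both-good z (markerR {z} G) G (right⇒left 0 zl z e Gl) (suc j * p) late))
      (inbox-from-left e Gl j)
    by-cases (no ¬Gl) with bad (suc j * p) z in b
    ... | true  = refl
    ... | false = ⊥-elim (¬Gl (left⇒right 0 zl z e (Flag.left-good z (markerR {z} G) G (suc j * p) late b)))

  -- Here the flag of the right marker decides, on the authority of the genuine block to its left.
  -- It is read at half time, which lies beyond `p + p` already for `j` equal to 2.
  from-right : ∀ {z zr} → z ℤ.+ + w ≡ zr → GoodR 0 z → ∀ j → 2 ≤ j → suc j ≤ W →
    let t* = h + suc (j * p) in mask (bad t* zr) (msg (regs t* zr)) ≡ visible (suc j) zr
  from-right {z} {zr} e G j 2≤j j≤ = by-cases (good-at? zr)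
    where
    t* : ℕ
    t* = h + suc (j * p)
    GL : GoodL 0 zr
    GL = right⇒left 0 z zr e G
    late : Flag.late zr (markerL {zr} GL) t*
    late = <-≤-trans (m<n+m (p + p) {w} z<s) (≤-trans
        (+-monoʳ-≤ w (≤-trans (≤-reflexive (lem p)) (*-monoˡ-≤ p 2≤j))) (≤-reflexive (sym (+-suc h (j * p)))))
      , ≤-trans (≤-reflexive (+-suc h (j * p))) (≤-trans (+-monoˡ-≤ (j * p) (m≤m+n w w)) (*-monoˡ-≤ p j≤))
      where
      lem : ∀ p → p + p ≡ 2 * p
      lem = solve-∀
    by-cases : ∀ d → mask (bad t* zr) (msg (regs t* zr)) ≡ (if does d then msg (ρ (suc j) zr) else nothing)
    by-cases (yes Gr) = trans
      (cong (λ b → mask b (msg (regs t* zr))) (Flag.both-good zr (markerL {zr} GL) Gr GL t* late))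
      (cong msg (trans (regs-const {zr} Gr j h (s≤s (m≤m+n h w))) (ρ-suc {zr} Gr j)))
    by-cases (no ¬Gr) with bad t* zr in b
    ... | true  = refl
    ... | false = ⊥-elim (¬Gr (Flag.right-good zr (markerL {zr} GL) GL t* late b))

  ρ-step : ∀ {zl z zr} → zl ℤ.+ + w ≡ z → z ℤ.+ + w ≡ zr → GoodR 0 z → ∀ j → 2 ≤ j → suc j < W →
    ρ (suc (suc j)) z ≡ exec (instr (suc j) os) (visible (suc j) zl) (ρ (suc j) z) (visible (suc j) zr)
  ρ-step {z = z} e e′ G j 2≤j j< = trans (ρ-exec {z} G (suc j) j< _ (payload-from-right {z} e′ G j))
    (cong₂ (λ l r → exec (instr (suc j) os) l (ρ (suc j) z) r) (from-left {z = z} e G j 2≤j (<⇒≤ j<))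
        (from-right {z} e′ G j 2≤j (<⇒≤ j<)))

  -- The three start-up operations ignore all messages, so flags that are still unreliable do no
  -- harm.
  ρ-3 : ∀ {z} → GoodR 0 z → ρ 3 z ≡ ρ 0 z
  ρ-3 {z} G = trans (ρ-exec {z} G 2 (s≤s (s≤s (s≤s z≤n))) _ (proj₂ (ping-at {z} G 2)))
    (trans (ρ-exec {z} G 1 (s≤s (s≤s z≤n)) _ (proj₂ (ping-at {z} G 1)))
        (ρ-exec {z} G 0 (s≤s z≤n) _ (proj₂ (ping-at {z} G 0))))

  -- Blocks are decoded on the lattice of multiples of `w` only. Adjacent blocks share a marker, so
  -- this lattice contains the neighbours of its blocks.
  position : ℤ → ℤ
  position i = i ℤ.* + w

  valid : ℤ → Bool
  valid i = does (good-at? (position i))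

  left-position : ∀ i → position (i ℤ.+ ℤ.-1ℤ) ℤ.+ + w ≡ position i
  left-position i = lem i (+ w)
    where
    lem : ∀ i w → (i ℤ.+ ℤ.-1ℤ) ℤ.* w ℤ.+ w ≡ i ℤ.* w
    lem = ℤˢ.solve-∀

  right-position : ∀ i → position i ℤ.+ + w ≡ position (i ℤ.+ ℤ.1ℤ)
  right-position i = lem i (+ w)
    where
    lem : ∀ i w → i ℤ.* w ℤ.+ w ≡ (i ℤ.+ ℤ.1ℤ) ℤ.* w
    lem = ℤˢ.solve-∀

  -- Where there is no block, `runOps` computes something meaningless, but `valid` hides it from the
  -- neighbours. Hence agreement at the genuine blocks is an invariant.
  run-correct : ∀ ops j → suc (suc (suc j)) + length ops ≡ W →
    (∀ n → instr (suc (suc (suc j)) + n) os ≡ instr n ops) →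
    ∀ s → (∀ i → GoodR 0 (position i) → s i ≡ ρ (suc (suc (suc j))) (position i)) →
    ∀ i → GoodR 0 (position i) → runOps valid ops s i ≡ ρ W (position i)
  run-correct [] j len is s S i G = trans (S i G) (cong (λ n → ρ n (position i)) (trans (sym (+-identityʳ _)) len))
  run-correct (o ∷ ops) j len is s S = run-correct ops (suc j)
    (trans (sym (+-suc (3 + j) (length ops))) len)
    (λ n → trans (cong (λ m → instr m os) (sym (+-suc (3 + j) n))) (is (suc n)))
    (parallel valid o s) S′
    where
    same : ∀ i → vis valid s i ≡ visible (3 + j) (position i)
    same i with good-at? (position i)
    ... | yes G = cong msg (S i G)
    ... | no _  = refl
    S′ : ∀ i → GoodR 0 (position i) → parallel valid o s i ≡ ρ (4 + j) (position i)
    S′ i G = sym (trans (ρ-step {z = position i} (left-position i) (right-position i) G (2 + j) (s≤s (s≤s z≤n)) j<)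
      (trans (cong (λ o → exec o (visible (3 + j) zl) (ρ (3 + j) (position i)) (visible (3 + j) zr))
                (trans (cong (λ m → instr m os) (sym (+-identityʳ (3 + j)))) (is 0)))
        (trans (cong₂ (λ l r → exec o l (ρ (3 + j) (position i)) r) (sym (same (i ℤ.+ ℤ.-1ℤ))) (sym (same (i ℤ.+ ℤ.1ℤ))))
          (cong (λ s′ → exec o (vis valid s (i ℤ.+ ℤ.-1ℤ)) s′ (vis valid s (i ℤ.+ ℤ.1ℤ))) (sym (S i G))))))
      where
      zl = position (i ℤ.+ ℤ.-1ℤ)
      zr = position (i ℤ.+ ℤ.1ℤ)
      j< : 3 + j < W
      j< = ≤-trans (m<m+n (3 + j) z<s) (≤-reflexive len)

  c-period-T : ∀ n → c (T + n) ≡ c n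
  c-period-T = period-multiple c p (Clock.c-period C) W

  x-period-T : ∀ n → x (T + n) ≡ x n
  -- Because `h` is `W + W`, the duration `T` is also `w * h`, a multiple of the period of `x`.
  x-period-T n = trans (cong (λ q → x (q + n)) (lem W)) (period-multiple x h (Clock.x-period C) w n)
    where
    lem : ∀ W → W * (suc (W + W) + suc (W + W)) ≡ suc (W + W) * (W + W)
    lem = solve-∀

  -- Whatever looks like a block after a pass was one before it, so the decoded configuration does
  -- not gain valid cells.
  good-period : ∀ z → Good h c x 0 (rowRight (X T) z) → GoodR 0 z
  good-period z G = VR.good-origin z C T
    (good-retime {row = rowRight (X T) z} (λ n → sym (c-period-T n)) (λ n → sym (x-period-T n)) G)

  good-period⁻¹ : ∀ z → GoodR 0 z → Good h c x 0 (rowRight (X T) z)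
  good-period⁻¹ z G = good-retime {row = rowRight (X T) z} c-period-T x-period-T (goodR-all {z} G T)

  simulates : ∀ i → content (does (good? h c x 0 (rowRight (X T) (position i)))) (regs T (position i))
    ≡ content (valid i) (runOps valid prog (λ i → regs 0 (position i)) i)
  simulates i with good? h c x 0 (rowRight (X T) (position i)) | good-at? (position i)
  ... | yes G | no ¬G = ⊥-elim (¬G (good-period (position i) G))
  ... | no ¬G | yes G = ⊥-elim (¬G (good-period⁻¹ (position i) G))
  ... | no _  | no _  = refl
  ... | yes _ | yes G = cong (λ s → just (mark s , bit s)) (sym
    (run-correct prog 0 refl (λ n → refl) (λ i → regs 0 (position i)) (λ i G → sym (ρ-3 {position i} G)) i G))

-- Programs for functions of a window

-- (k , l) means k transfers from the right followed by l transfers from the left.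
Offset : Set
Offset = ℕ × ℕ

fetch : Offset → List Op
fetch (k , l) = reset ∷ replicate k fromRight ++ replicate l fromLeft

-- What k successive transfers from the neighbour at distance e bring to a cell:
-- blocks that are not valid let nothing through.
look : (ℤ → Message) → ℤ → ℕ → (ℤ → Message) → ℤ → Message
look x e zero    g = g
look x e (suc k) g = look x e k (λ i → x (i ℤ.+ e) >>= λ _ → g (i ℤ.+ e))

view : (ℤ → Message) → Offset → ℤ → Message
view x (k , l) = look x ℤ.-1ℤ l (look x ℤ.1ℤ k x)

tests : ∀ {n} → Vec Offset n → Vec Message n → List Op
tests []       []       = []
tests (d ∷ ds) (q ∷ qs) = fetch d ++ test q ∷ tests ds qs

entry : ∀ {n} → Vec Offset n → (Vec Message n → Bool) → Vec Message n → List Op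
entry ds g qs = arm ∷ tests ds qs ++ put (g qs) ∷ []

messages : List Message
messages = nothing ∷ just (false , false) ∷ just (false , true) ∷ just (true , false) ∷ just (true , true) ∷ []

∈-messages : ∀ m → m ∈ messages
∈-messages nothing                = here refl
∈-messages (just (false , false)) = there (here refl)
∈-messages (just (false , true))  = there (there (here refl))
∈-messages (just (true , false))  = there (there (there (here refl)))
∈-messages (just (true , true))   = there (there (there (there (here refl))))

patterns : ∀ n → List (Vec Message n)
patterns zero    = [] ∷ []
patterns (suc n) = cartesianProductWith _∷_ messages (patterns n)

∈-patterns : ∀ {n} (qs : Vec Message n) → qs ∈ patterns n
∈-patterns []       = here refl
∈-patterns (q ∷ qs) = ∈-cartesianProductWith⁺ _∷_ (∈-messages q) (∈-patterns qs)

table : ∀ {n} → Vec Offset n → (Vec Message n → Bool) → List (Vec Message n) → List Op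
table ds g []         = []
table ds g (qs ∷ qss) = entry ds g qs ++ table ds g qss

compile : ∀ {n} → Vec Offset n → (Vec Message n → Bool) → List Op
compile {n} ds g = table ds g (patterns n) ++ commit ∷ []

Ordinary : List Op → Set
Ordinary = All (λ o → isInit o ≡ false)

ordinary-compile : ∀ {n} (ds : Vec Offset n) g → Ordinary (compile ds g)
ordinary-compile {n} ds g = Allₚ.++⁺ (ordinary-table (patterns n)) (refl ∷ [])
  where
  ordinary-replicate : ∀ k {o} → isInit o ≡ false → Ordinary (replicate k o)
  ordinary-replicate zero    e = []
  ordinary-replicate (suc k) e = e ∷ ordinary-replicate k e
  ordinary-tests : ∀ {n} (ds : Vec Offset n) qs → Ordinary (tests ds qs)
  ordinary-tests []             []       = []
  ordinary-tests ((k , l) ∷ ds) (q ∷ qs) = Allₚ.++⁺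
    (refl ∷ Allₚ.++⁺ (ordinary-replicate k refl) (ordinary-replicate l refl)) (refl ∷ ordinary-tests ds qs)
  ordinary-table : ∀ qss → Ordinary (table ds g qss)
  ordinary-table []         = []
  ordinary-table (qs ∷ qss) = Allₚ.++⁺ (refl ∷ Allₚ.++⁺ (ordinary-tests ds qs) (refl ∷ [])) (ordinary-table qss)

runOps-++ : ∀ v os os′ s → runOps v (os ++ os′) s ≡ runOps v os′ (runOps v os s)
runOps-++ v []       os′ s = refl
runOps-++ v (o ∷ os) os′ s = runOps-++ v os os′ (parallel v o s)

applied : ∀ {n} → Vec Offset n → (Vec Message n → Bool) → (ℤ → Message) → ℤ → Message
applied ds g x i = Maybe.map (λ mb → proj₁ mb , g (Vec.map (λ d → view x d i) ds)) (x i)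

module Parallel (v : ℤ → Bool) (x : ℤ → Message) where

  -- As `put` writes to `new` only, this invariant persists until `commit`, and all fetches of the
  -- whole table read the same old configuration.
  Holds : (ℤ → Reg) → Set
  Holds s = ∀ i → content (v i) (s i) ≡ x i

  record Fetched (s s′ : ℤ → Reg) (g : ℤ → Message) : Set where
    field
      holds  : Holds s′
      armed≡ : ∀ i → armed (s′ i) ≡ armed (s i)
      new≡   : ∀ i → new (s′ i) ≡ new (s i)
      msg≡   : ∀ i → v i ≡ true → msg (s′ i) ≡ g i

  fetched-trans : ∀ {s s′ s″ g g′} → Fetched s s′ g → Fetched s′ s″ g′ → Fetched s s″ g′
  fetched-trans F F′ = record
    { holds  = Fetched.holds F′
    ; armed≡ = λ i → trans (Fetched.armed≡ F′ i) (Fetched.armed≡ F i)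
    ; new≡   = λ i → trans (Fetched.new≡ F′ i) (Fetched.new≡ F i)
    ; msg≡   = Fetched.msg≡ F′ }

  vis≡ : ∀ {s : ℤ → Reg} {g : ℤ → Message} → Holds s → (∀ i → v i ≡ true → msg (s i) ≡ g i) → ∀ i → vis v s i ≡
      (x i >>= λ _ → g i)
  vis≡ {s} {g} H M i with v i in e | H i
  ... | true  | e′ = trans (M i e) (cong (_>>= (λ _ → g i)) e′)
  ... | false | e′ = cong (_>>= (λ _ → g i)) e′

  shifts : ∀ {o e} → (∀ s i → parallel v o s i ≡ record (s i) { msg = vis v s (i ℤ.+ e) }) →
    ∀ k {s : ℤ → Reg} {g : ℤ → Message} → Holds s → (∀ i → v i ≡ true → msg (s i) ≡ g i) →
    Fetched s (runOps v (replicate k o) s) (look x e k g)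
  shifts O zero    H M = record { holds = H ; armed≡ = λ _ → refl ; new≡ = λ _ → refl ; msg≡ = M }
  shifts {o} {e} O (suc k) {s} {g} H M = fetched-trans {s′ = parallel v o s} F
      (shifts O k {parallel v o s} (Fetched.holds F) (Fetched.msg≡ F))
    where
    F : Fetched s (parallel v o s) (λ i → x (i ℤ.+ e) >>= λ _ → g (i ℤ.+ e))
    F = record
      { holds  = λ i → trans (cong (content (v i)) (O s i)) (H i)
      ; armed≡ = λ i → cong armed (O s i)
      ; new≡   = λ i → cong new (O s i)
      ; msg≡   = λ i _ → trans (cong msg (O s i)) (vis≡ {s} {g} H M (i ℤ.+ e)) }

  fetches : ∀ d {s} → Holds s → Fetched s (runOps v (fetch d) s) (view x d)
  fetches (k , l) {s} H = subst (λ s′ → Fetched s s′ (view x (k , l)))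
    (sym (runOps-++ v (replicate k fromRight) (replicate l fromLeft) s₁))
    (fetched-trans F₂ (shifts {e = ℤ.-1ℤ} (λ _ _ → refl) l {runOps v (replicate k fromRight) s₁} (Fetched.holds F₂)
        (Fetched.msg≡ F₂)))
    where
    s₁ : ℤ → Reg
    s₁ = parallel v reset s
    F₁ : Fetched s s₁ x
    F₁ = record { holds = H ; armed≡ = λ _ → refl ; new≡ = λ _ → refl ; msg≡ = stored }
      where
      stored : ∀ i → v i ≡ true → just (mark (s i) , bit (s i)) ≡ x i
      stored i e = trans (cong (λ b → content b (s i)) (sym e)) (H i)
    F₂ : Fetched s (runOps v (replicate k fromRight) s₁) (look x ℤ.1ℤ k x)
    F₂ = fetched-trans F₁ (shifts {e = ℤ.1ℤ} (λ _ _ → refl) k {s₁} (Fetched.holds F₁) (Fetched.msg≡ F₁))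

  agrees : ∀ {n} → Vec Offset n → Vec Message n → ℤ → Bool
  agrees []       []       i = true
  agrees (d ∷ ds) (q ∷ qs) i = does (view x d i ≟ᵐ q) ∧ agrees ds qs i

  agrees-refl : ∀ {n} (ds : Vec Offset n) i → agrees ds (Vec.map (λ d → view x d i) ds) i ≡ true
  agrees-refl []       i = refl
  agrees-refl (d ∷ ds) i = cong₂ _∧_ (dec-true (view x d i ≟ᵐ view x d i) refl) (agrees-refl ds i)

  agrees⇒≡ : ∀ {n} (ds : Vec Offset n) qs i → agrees ds qs i ≡ true → qs ≡ Vec.map (λ d → view x d i) ds
  agrees⇒≡ []       []       i _ = refl
  agrees⇒≡ (d ∷ ds) (q ∷ qs) i e with view x d i ≟ᵐ q
  ... | yes e′ = cong₂ _∷_ (sym e′) (agrees⇒≡ ds qs i e)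
  agrees⇒≡ (d ∷ ds) (q ∷ qs) i () | no _

  record Tested (s s′ : ℤ → Reg) (a : ℤ → Bool) : Set where
    field
      holds  : Holds s′
      armed≡ : ∀ i → v i ≡ true → armed (s′ i) ≡ armed (s i) ∧ a i
      new≡   : ∀ i → new (s′ i) ≡ new (s i)

  tested : ∀ {n} (ds : Vec Offset n) qs {s} → Holds s → Tested s (runOps v (tests ds qs) s) (agrees ds qs)
  tested []       []       H = record { holds = H ; armed≡ = λ i _ → sym (∧-identityʳ _) ; new≡ = λ _ → refl }
  tested (d ∷ ds) (q ∷ qs) {s} H = subst (λ s′ → Tested s s′ (agrees (d ∷ ds) (q ∷ qs)))
    (sym (runOps-++ v (fetch d) (test q ∷ tests ds qs) s)) record
      { holds  = Tested.holds Ts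
      ; armed≡ = λ i e → trans (Tested.armed≡ Ts i e) (trans
          (cong₂ (λ a m → (a ∧ does (m ≟ᵐ q)) ∧ agrees ds qs i) (Fetched.armed≡ F i) (Fetched.msg≡ F i e))
          (∧-assoc (armed (s i)) _ _))
      ; new≡   = λ i → trans (Tested.new≡ Ts i) (Fetched.new≡ F i) }
    where
    F : Fetched s (runOps v (fetch d) s) (view x d)
    F = fetches d {s} H
    Ts : Tested (parallel v (test q) (runOps v (fetch d) s)) _ (agrees ds qs)
    Ts = tested ds qs {parallel v (test q) (runOps v (fetch d) s)} (Fetched.holds F)

  module _ {n} (ds : Vec Offset n) (g : Vec Message n → Bool) where

    seen : ℤ → Vec Message n
    seen i = Vec.map (λ d → view x d i) ds

    entered : ∀ qs {s} → Holds s → let s′ = runOps v (entry ds g qs) s in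
      Holds s′ × (∀ i → v i ≡ true → new (s′ i) ≡ (if agrees ds qs i then g qs else new (s i)))
    entered qs {s} H = subst (λ s′ → Holds s′ ×
        (∀ i → v i ≡ true → new (s′ i) ≡ (if agrees ds qs i then g qs else new (s i))))
      (sym (runOps-++ v (tests ds qs) (put (g qs) ∷ []) s₁))
      (Tested.holds Ts , λ i e → cong₂ (λ a b → if a then g qs else b) (Tested.armed≡ Ts i e) (Tested.new≡ Ts i))
      where
      s₁ : ℤ → Reg
      s₁ = parallel v arm s
      Ts : Tested s₁ (runOps v (tests ds qs) s₁) (agrees ds qs)
      Ts = tested ds qs {s₁} H

    -- The disjunction is the loop invariant: either the line for the window of the cell is still to
    -- come, or `new` already has the right value. Lines for other windows fail their tests and
    -- leave `new` alone.
    tabled : ∀ qss {s} → Holds s → let s′ = runOps v (table ds g qss) s in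
      Holds s′ × (∀ i → v i ≡ true → seen i ∈ qss ⊎ new (s i) ≡ g (seen i) → new (s′ i) ≡ g (seen i))
    tabled [] H = H , λ { i e (inj₂ done) → done }
    tabled (qs ∷ qss) {s} H = subst (λ s′ → Holds s′ ×
        (∀ i → v i ≡ true → seen i ∈ (qs ∷ qss) ⊎ new (s i) ≡ g (seen i) → new (s′ i) ≡ g (seen i)))
      (sym (runOps-++ v (entry ds g qs) (table ds g qss) s))
      (proj₁ rec , λ i e o → proj₂ rec i e (choose i e o (agrees ds qs i) refl))
      where
      s₁ : ℤ → Reg
      s₁ = runOps v (entry ds g qs) s
      rec = tabled qss {s₁} (proj₁ (entered qs {s} H))
      choose : ∀ i → v i ≡ true → seen i ∈ (qs ∷ qss) ⊎ new (s i) ≡ g (seen i) → ∀ a → agrees ds qs i ≡ a →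
        seen i ∈ qss ⊎ new (s₁ i) ≡ g (seen i)
      choose i e o true  ag = inj₂ (trans (proj₂ (entered qs {s} H) i e)
          (trans (cong (λ a → if a then g qs else new (s i)) ag) (cong g (agrees⇒≡ ds qs i ag))))
      choose i e (inj₁ (here refl)) false ag = contradiction (trans (sym (agrees-refl ds i)) ag) λ ()
      choose i e (inj₁ (there m))   false ag = inj₁ m
      choose i e (inj₂ done)        false ag = inj₂
          (trans (proj₂ (entered qs {s} H) i e) (trans (cong (λ a → if a then g qs else new (s i)) ag) done))

    compiled : ∀ {s} → Holds s → ∀ i → content (v i) (runOps v (compile ds g) s i) ≡ applied ds g x i
    compiled {s} H i = trans (cong (λ s′ → content (v i) (s′ i)) (runOps-++ v (table ds g (patterns n)) (commit ∷ []) s))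
      (go (v i) refl)
      where
      s₁ : ℤ → Reg
      s₁ = runOps v (table ds g (patterns n)) s
      rec = tabled (patterns n) {s} H
      go : ∀ b → v i ≡ b → content b (parallel v commit s₁ i) ≡ applied ds g x i
      go true  e = trans (cong (λ b → just (mark (s₁ i) , b)) (proj₂ rec i e (inj₁ (∈-patterns (seen i)))))
        (cong (Maybe.map (λ mb → proj₁ mb , g (seen i))) (trans (cong (λ b → content b (s₁ i)) (sym e)) (proj₁ rec i)))
      go false e = cong (Maybe.map (λ mb → proj₁ mb , g (seen i)))
          (trans (cong (λ b → content b (s₁ i)) (sym e)) (proj₁ rec i))

-- Groups of blocks

search : ∀ {m} {A : Set} → (Fin m → Bool) → (Fin m → A) → A → A
search {zero}  b f d = d
search {suc m} b f d = if b zero then f zero else search (b ∘ suc) (f ∘ suc) d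

search-cong : ∀ {m} {A : Set} {b b′ : Fin m → Bool} → b ≗ b′ → ∀ (f : Fin m → A) d → search b f d ≡ search b′ f d
search-cong {zero}  e f d = refl
search-cong {suc m} {b = b} {b′} e f d rewrite e zero with b′ zero
... | true  = refl
... | false = search-cong (e ∘ suc) (f ∘ suc) d

oneHot : ∀ {m} → Fin m → Fin m → Bool
oneHot q p = does (q Finₚ.≟ p)

search-oneHot : ∀ {m} {A : Set} (q : Fin m) (f : Fin m → A) d → search (oneHot q) f d ≡ f q
search-oneHot zero    f d = refl
search-oneHot (suc q) f d = search-oneHot q (f ∘ suc) d

isZero : ℕ → Bool
isZero zero    = true
isZero (suc _) = false

marks : Message → Maybe Bool
marks = Maybe.map proj₁

bits : Message → Bool
bits = Maybe.maybe proj₂ false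

marks⇒just : ∀ m {b} → marks m ≡ just b → ∃ λ s → m ≡ just s
marks⇒just (just s) _ = s , refl

next-step : ∀ i k e → i ℤ.+ + suc k ℤ.* e ≡ i ℤ.+ + k ℤ.* e ℤ.+ e
next-step i k e = lem i (+ k) e
  where
  lem : ∀ i k e → i ℤ.+ (ℤ.1ℤ ℤ.+ k) ℤ.* e ≡ i ℤ.+ k ℤ.* e ℤ.+ e
  lem = ℤˢ.solve-∀

-- Defects on the way can suppress a symbol but never alter it.
look-sound : ∀ x e k g i {m} → look x e k g i ≡ just m → g (i ℤ.+ + k ℤ.* e) ≡ just m
look-sound x e zero    g i eq = trans (cong g (ℤₚ.+-identityʳ i)) eq
look-sound x e (suc k) g i eq with x (i ℤ.+ + k ℤ.* e ℤ.+ e) | look-sound x e k _ i eq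
... | just _ | eq′ = trans (cong g (next-step i k e)) eq′

look-complete : ∀ x e k g i → (∀ m → m < k → ∃ λ s → x (i ℤ.+ + suc m ℤ.* e) ≡ just s) →
  look x e k g i ≡ g (i ℤ.+ + k ℤ.* e)
look-complete x e zero    g i filled = cong g (sym (ℤₚ.+-identityʳ i))
look-complete x e (suc k) g i filled with filled k ≤-refl
... | _ , eq = trans (look-complete x e k _ i (λ m m<k → filled m (<⇒≤ (s≤s m<k))))
  (trans (cong (_>>= (λ _ → g (i ℤ.+ + k ℤ.* e ℤ.+ e))) (trans (cong x (sym (next-step i k e))) eq))
      (cong g (sym (next-step i k e))))

-- One component is always 0, so the symbol travels straight and depends only on the blocks along
-- the way.
towards : ℕ → ℕ → Offset
towards a b = b ∸ a , a ∸ b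

∸-∸ : ∀ a b → + (b ∸ a) ℤ.- + (a ∸ b) ≡ + b ℤ.- + a
∸-∸ zero    zero    = refl
∸-∸ zero    (suc b) = refl
∸-∸ (suc a) zero    = refl
∸-∸ (suc a) (suc b) = trans (∸-∸ a b) (lem (+ a) (+ b))
  where
  lem : ∀ a b → b ℤ.- a ≡ (ℤ.1ℤ ℤ.+ b) ℤ.- (ℤ.1ℤ ℤ.+ a)
  lem = ℤˢ.solve-∀

view-sound : ∀ x a b i {m} → view x (towards a b) i ≡ just m → x (i ℤ.+ (+ b ℤ.- + a)) ≡ just m
view-sound x a b i e = trans (cong x (trans (cong (λ d → i ℤ.+ d) (sym (∸-∸ a b))) (lem i (+ (b ∸ a)) (+ (a ∸ b)))))
  (look-sound x ℤ.1ℤ (b ∸ a) x _ (look-sound x ℤ.-1ℤ (a ∸ b) _ i e))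
  where
  lem : ∀ i k l → i ℤ.+ (k ℤ.- l) ≡ i ℤ.+ l ℤ.* ℤ.-1ℤ ℤ.+ k ℤ.* ℤ.1ℤ
  lem = ℤˢ.solve-∀

view-complete : ∀ x B lo hi → (∀ m → lo ≤ m → m < hi → ∃ λ s → x (B ℤ.+ + m) ≡ just s) →
  ∀ a b → lo ≤ a → a < hi → lo ≤ b → b < hi → view x (towards a b) (B ℤ.+ + a) ≡ x (B ℤ.+ + b)
view-complete x B lo hi filled a b lo≤a a<hi lo≤b b<hi with ≤-total a b
... | inj₁ a≤b rewrite m≤n⇒m∸n≡0 a≤b = trans
  (look-complete x ℤ.1ℤ (b ∸ a) x (B ℤ.+ + a) (λ m m< → subst (λ z → ∃ λ s → x z ≡ just s) (lem₁ B (+ a) (+ m))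
    (filled (a + suc m) (≤-trans lo≤a (m≤m+n a (suc m)))
        (<-≤-trans (s≤s (≤-trans (+-monoʳ-≤ a m<) (≤-reflexive (m+[n∸m]≡n a≤b)))) b<hi))))
  (cong x (trans (lem₂ B (+ a) (+ (b ∸ a))) (cong (λ n → B ℤ.+ + n) (m+[n∸m]≡n a≤b))))
  where
  lem₁ : ∀ B a m → B ℤ.+ (a ℤ.+ (ℤ.1ℤ ℤ.+ m)) ≡ B ℤ.+ a ℤ.+ (ℤ.1ℤ ℤ.+ m) ℤ.* ℤ.1ℤ
  lem₁ = ℤˢ.solve-∀
  lem₂ : ∀ B a d → B ℤ.+ a ℤ.+ d ℤ.* ℤ.1ℤ ≡ B ℤ.+ (a ℤ.+ d)
  lem₂ = ℤˢ.solve-∀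
... | inj₂ b≤a rewrite m≤n⇒m∸n≡0 b≤a = trans
  (look-complete x ℤ.-1ℤ (a ∸ b) x (B ℤ.+ + a) (λ m m< → subst (λ z → ∃ λ s → x z ≡ just s)
      (trans (lem₁ B (+ (a ∸ suc m)) (+ m)) (cong (λ n → B ℤ.+ + n ℤ.+ + suc m ℤ.* ℤ.-1ℤ)
          (m∸n+n≡m (≤-trans m< (m∸n≤m a b)))))
    (filled (a ∸ suc m) (≤-trans lo≤b (≤-trans (≤-reflexive (sym (m∸[m∸n]≡n b≤a))) (∸-monoʳ-≤ a m<)))
        (≤-<-trans (m∸n≤m a (suc m)) a<hi))))
  (cong x (trans (cong (λ n → B ℤ.+ + n ℤ.+ + (a ∸ b) ℤ.* ℤ.-1ℤ) (sym (m+[n∸m]≡n b≤a))) (lem₂ B (+ b) (+ (a ∸ b)))))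
  where
  lem₁ : ∀ B r m → B ℤ.+ r ≡ B ℤ.+ (r ℤ.+ (ℤ.1ℤ ℤ.+ m)) ℤ.+ (ℤ.1ℤ ℤ.+ m) ℤ.* ℤ.-1ℤ
  lem₁ = ℤˢ.solve-∀
  lem₂ : ∀ B b d → B ℤ.+ (b ℤ.+ d) ℤ.+ d ℤ.* ℤ.-1ℤ ≡ B ℤ.+ b
  lem₂ = ℤˢ.solve-∀

module Group {n : ℕ} (v₀ : Fin n) where

  Legal : (Fin n → Message) → Set
  Legal G = ∀ q → marks (G q) ≡ just (isZero (toℕ q))

  legal? : ∀ G → Dec (Legal G)
  legal? G = Finₚ.all? λ q → Maybeₚ.≡-dec _≟ᵇ_ (marks (G q)) (just (isZero (toℕ q)))

  abstract

    -- Decoding must be total: the first bit that is set counts, and a group with a defect or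
    -- without any such bit has the value `v₀`.
    decode : (Fin n → Message) → Fin n
    decode G = if does (legal? G) then search (bits ∘ G) id v₀ else v₀

    decode-illegal : ∀ G → ¬ Legal G → decode G ≡ v₀
    decode-illegal G ¬L = cong (λ b → if b then search (bits ∘ G) id v₀ else v₀) (dec-false (legal? G) ¬L)

    decode-legal : ∀ G → Legal G → decode G ≡ search (bits ∘ G) id v₀
    decode-legal G L = cong (λ b → if b then search (bits ∘ G) id v₀ else v₀) (dec-true (legal? G) L)

  -- `G` is what a cell sees of the actual group `H`, possibly with gaps. If `H` is legal, nothing
  -- is missing; otherwise `G` is not legal either, and both yield `v₀`.
  decode-cong : ∀ {G H} → (∀ q {m} → G q ≡ just m → H q ≡ just m) → (Legal H → ∀ q → G q ≡ H q) → decode G ≡ decode H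
  decode-cong {G} {H} sound complete with legal? H
  ... | yes L = trans (decode-legal G L′) (trans (search-cong (λ q → cong bits (complete L q)) id v₀)
      (sym (decode-legal H L)))
    where
    L′ : Legal G
    L′ q = trans (cong marks (complete L q)) (L q)
  ... | no ¬L = trans (decode-illegal G λ L → ¬L λ q → let (s , e) = marks⇒just (G q) (L q) in
    trans (cong marks (sound q e)) (trans (cong marks (sym e)) (L q))) (sym (decode-illegal H ¬L))

  -- A cell does not know its index in its group, so it looks at the three groups once for every
  -- possible index. Positions are counted from the start of the left group.
  window : ℕ
  window = n * (3 * n)

  offsets : Vec Offset window
  offsets = Vec.tabulate λ e → let (p , sq) = remQuot {n} (3 * n) e ; (s , q) = remQuot {3} n sq in
    towards (1 * n + toℕ p) (toℕ s * n + toℕ q)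

  -- What a cell sees of the group number s of the three groups around it, if it has index p in its own group.
  around : Vec Message window → Fin n → Fin 3 → Fin n → Message
  around ω p s q = Vec.lookup ω (combine p (combine s q))

  left own right : Fin 3
  left  = zero
  own   = suc zero
  right = suc (suc zero)

  module _ (f : Fin n → Fin n → Fin n → Fin n) where

    newValue : Vec Message window → Fin n → Fin n
    newValue ω p = f (decode (around ω p left)) (decode (around ω p own)) (decode (around ω p right))

    -- The right index is recognized by the fact that it makes the cell's own group look legal;
    -- `own-index` shows that no other index does.
    newBit : Vec Message window → Bool
    newBit ω with Finₚ.any? (λ p → legal? (around ω p own))
    ... | yes (p , _) = oneHot (newValue ω p) p
    ... | no _        = false

  seenAt : (ℤ → Message) → ℤ → Vec Message window
  seenAt x i = Vec.map (λ d → view x d i) offsets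

  around-seen : ∀ x i p s q → around (seenAt x i) p s q ≡ view x (towards (1 * n + toℕ p) (toℕ s * n + toℕ q)) i
  around-seen x i p s q = trans (Vecₚ.lookup-map (combine p (combine s q)) (λ d → view x d i) offsets)
    (cong (λ d → view x d i) (trans (Vecₚ.lookup∘tabulate _ (combine p (combine s q)))
      (trans (cong (λ psq → towards (1 * n + toℕ (proj₁ psq))
          (toℕ (proj₁ (remQuot {3} n (proj₂ psq))) * n + toℕ (proj₂ (remQuot {3} n (proj₂ psq)))))
                (remQuot-combine p (combine s q)))
             (cong (λ sq → towards (1 * n + toℕ p) (toℕ (proj₁ sq) * n + toℕ (proj₂ sq))) (remQuot-combine s q)))))

  block : (ℤ → Message) → ℤ → Fin 3 → Fin n → Message
  block x B s q = x (B ℤ.+ + (toℕ s * n + toℕ q))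

  block-just : ∀ x B s → Legal (block x B s) → ∀ m → toℕ s * n ≤ m → m < toℕ s * n + n → ∃ λ y → x (B ℤ.+ + m) ≡ just y
  block-just x B s L m lo hi = marks⇒just _ (subst (λ m → marks (x (B ℤ.+ + m)) ≡ just (isZero (toℕ (fromℕ< d<n))))
    (trans (cong (λ d → toℕ s * n + d) (toℕ-fromℕ< d<n)) (m+[n∸m]≡n lo)) (L (fromℕ< d<n)))
    where
    d<n : m ∸ toℕ s * n < n
    d<n = +-cancelˡ-< (toℕ s * n) _ n (subst (_< toℕ s * n + n) (sym (m+[n∸m]≡n lo)) hi)

  isZero-pos : ∀ {d} → 0 < d → isZero d ≢ true
  isZero-pos {suc d} _ ()

  module _ (x : ℤ → Message) (B : ℤ) (L : Legal (block x B own)) (p : Fin n) where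

    private
      i : ℤ
      i = B ℤ.+ + (1 * n + toℕ p)

      0<n : 0 < n
      0<n = ≤-<-trans z≤n (toℕ<n p)

    own-mark : ∀ d → d < n → marks (x (B ℤ.+ + (1 * n + d))) ≡ just (isZero d)
    own-mark d d<n = subst (λ d → marks (x (B ℤ.+ + (1 * n + d))) ≡ just (isZero d)) (toℕ-fromℕ< d<n) (L (fromℕ< d<n))

    seen-mark : ∀ p′ → Legal (around (seenAt x i) p′ own) → ∀ q d → q < n → q + toℕ p ≡ d + toℕ p′ →
      marks (x (B ℤ.+ + (1 * n + d))) ≡ just (isZero q)
    seen-mark p′ L′ q d q<n e with L′ (fromℕ< q<n)
    ... | m rewrite around-seen x i p′ own (fromℕ< q<n) | toℕ-fromℕ< q<n with marks⇒just _ m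
    ... | s , e′ = trans (cong marks (trans (cong x (sym place)) (view-sound x (1 * n + toℕ p′) (1 * n + q) i e′)))
      (trans (sym (cong marks e′)) m)
      where
      lem₁ : ∀ B n p q p′ → B ℤ.+ (n ℤ.+ p) ℤ.+ ((n ℤ.+ q) ℤ.- (n ℤ.+ p′)) ≡ B ℤ.+ (n ℤ.+ (q ℤ.+ p)) ℤ.- p′
      lem₁ = ℤˢ.solve-∀
      lem₂ : ∀ B n d p′ → B ℤ.+ (n ℤ.+ (d ℤ.+ p′)) ℤ.- p′ ≡ B ℤ.+ (n ℤ.+ d)
      lem₂ = ℤˢ.solve-∀
      place : i ℤ.+ (+ (1 * n + q) ℤ.- + (1 * n + toℕ p′)) ≡ B ℤ.+ + (1 * n + d)
      place = trans (lem₁ B (+ (1 * n)) (+ toℕ p) (+ q) (+ toℕ p′))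
        (trans (cong (λ m → B ℤ.+ (+ (1 * n) ℤ.+ + m) ℤ.- + toℕ p′) e) (lem₂ B (+ (1 * n)) (+ d) (+ toℕ p′)))

    -- Two legal readings with different indices would be shifted against each other, and the marked
    -- first member of one would be an unmarked later member of the other.
    own-index : ∀ p′ → Legal (around (seenAt x i) p′ own) → p′ ≡ p
    own-index p′ L′ with <-cmp (toℕ p′) (toℕ p)
    ... | tri≈ _ e _ = Finₚ.toℕ-injective e
    ... | tri< lt _ _ = contradiction
      (Maybeₚ.just-injective (trans (sym (own-mark d (≤-<-trans (m∸n≤m _ (toℕ p′)) (toℕ<n p))))
        (seen-mark p′ L′ 0 d 0<n (sym (m∸n+n≡m (<⇒≤ lt))))))
      (isZero-pos (m<n⇒0<n∸m lt))
      where
      d : ℕ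
      d = toℕ p ∸ toℕ p′
    ... | tri> _ _ gt = contradiction
      (Maybeₚ.just-injective (trans (sym (seen-mark p′ L′ d 0 (≤-<-trans (m∸n≤m _ (toℕ p)) (toℕ<n p′)) (m∸n+n≡m (<⇒≤ gt))))
        (own-mark 0 0<n)))
      (isZero-pos (m<n⇒0<n∸m gt))
      where
      d : ℕ
      d = toℕ p′ ∸ toℕ p

    around-sound : ∀ s q {m} → around (seenAt x i) p s q ≡ just m → block x B s q ≡ just m
    around-sound s q e = trans (cong x (sym (lem B (+ (1 * n + toℕ p)) (+ (toℕ s * n + toℕ q)))))
      (view-sound x (1 * n + toℕ p) (toℕ s * n + toℕ q) i (trans (sym (around-seen x i p s q)) e))
      where
      lem : ∀ B a b → B ℤ.+ a ℤ.+ (b ℤ.- a) ≡ B ℤ.+ b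
      lem = ℤˢ.solve-∀

    -- All blocks between the cell and a legal group belong to this group or to the cell's own legal
    -- group, so no transfer is interrupted.
    around-complete : ∀ s → Legal (block x B s) → ∀ q → around (seenAt x i) p s q ≡ block x B s q
    around-complete s L′ q = trans (around-seen x i p s q) (go s L′)
      where
      just-own = block-just x B own L
      own-hi : 1 * n + toℕ p < 1 * n + n
      own-hi = +-monoʳ-< (1 * n) (toℕ<n p)
      go : ∀ s → Legal (block x B s) → view x (towards (1 * n + toℕ p) (toℕ s * n + toℕ q)) i ≡ block x B s q
      go zero L′ = view-complete x B 0 (1 * n + n) filled (1 * n + toℕ p) (toℕ q) z≤n own-hi z≤n
        (<-≤-trans (toℕ<n q) (m≤n+m n (1 * n)))
        where
        filled : ∀ m → 0 ≤ m → m < 1 * n + n → _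
        filled m _ hi with m <? 1 * n
        ... | yes lt = block-just x B left L′ m z≤n (subst (m <_) (*-identityˡ n) lt)
        ... | no ge  = just-own m (≮⇒≥ ge) hi
      go (suc zero) L′ = view-complete x B (1 * n) (1 * n + n) just-own (1 * n + toℕ p) (1 * n + toℕ q)
        (m≤m+n (1 * n) (toℕ p)) own-hi (m≤m+n (1 * n) (toℕ q)) (+-monoʳ-< (1 * n) (toℕ<n q))
      go (suc (suc zero)) L′ = view-complete x B (1 * n) (2 * n + n) filled (1 * n + toℕ p) (2 * n + toℕ q)
        (m≤m+n (1 * n) (toℕ p)) (<-≤-trans own-hi (+-monoˡ-≤ n 1n≤2n)) (≤-trans 1n≤2n (m≤m+n (2 * n) (toℕ q)))
            (+-monoʳ-< (2 * n) (toℕ<n q))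
        where
        1n≤2n : 1 * n ≤ 2 * n
        1n≤2n = m≤n+m (1 * n) n
        filled : ∀ m → 1 * n ≤ m → m < 2 * n + n → _
        filled m lo hi with m <? 2 * n
        ... | yes lt = just-own m lo (subst (m <_) (+-comm n (1 * n)) lt)
        ... | no ge  = block-just x B right L′ m (≮⇒≥ ge) hi

    decode-around : ∀ s → decode (around (seenAt x i) p s) ≡ decode (block x B s)
    decode-around s = decode-cong (around-sound s) (around-complete s)

    newBit-legal : ∀ f → newBit f (seenAt x i) ≡
      oneHot (f (decode (block x B left)) (decode (block x B own)) (decode (block x B right))) p
    newBit-legal f with Finₚ.any? (λ p′ → legal? (around (seenAt x i) p′ own))
    ... | no ¬a = ⊥-elim (¬a (p , λ q → trans (cong marks (around-complete own L q)) (L q)))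
    ... | yes (p′ , L′) with own-index p′ L′
    ... | refl = cong (λ v → oneHot v p) (trans (cong₂ (λ a b → f a b (decode (around (seenAt x i) p right)))
        (decode-around left) (decode-around own)) (cong (f _ _) (decode-around right)))

  module _ (f : Fin n → Fin n → Fin n → Fin n) (persist : ∀ l r → f l v₀ r ≡ v₀) where

    marks-applied : ∀ x i → marks (applied offsets (newBit f) x i) ≡ marks (x i)
    marks-applied x i with x i
    ... | just _  = refl
    ... | nothing = refl

    bits-applied : ∀ x i {s} → x i ≡ just s → bits (applied offsets (newBit f) x i) ≡ newBit f (seenAt x i)
    bits-applied x i e = cong (λ m → bits (Maybe.map (λ mb → proj₁ mb , newBit f (seenAt x i)) m)) e

    -- Marks and validity never change. A legal group computes `f`; an illegal one stays illegal and
    -- keeps the value `v₀`, which agrees with `f` by `persist`.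
    group-step : ∀ x B → decode (block (applied offsets (newBit f) x) B own) ≡
      f (decode (block x B left)) (decode (block x B own)) (decode (block x B right))
    group-step x B with legal? (block x B own)
    ... | no ¬L = trans (decode-illegal _ λ L → ¬L λ q → trans (sym (marks-applied x _)) (L q))
      (sym (trans (cong (λ v → f (decode (block x B left)) v (decode (block x B right))) (decode-illegal _ ¬L))
          (persist _ _)))
    ... | yes L = trans (decode-legal _ λ q → trans (marks-applied x _) (L q))
      (trans (search-cong (λ p → trans (bits-applied x _ (proj₂ (marks⇒just _ (L p)))) (newBit-legal x B L p f)) id v₀)
        (search-oneHot _ id v₀))

-- The factor map

abs-diff-< : ∀ a b r → a < r → b < r → ∣ + a ℤ.- + b ∣ < r
abs-diff-< a b r a<r b<r = ≤-<-trans (≤-reflexive (cong ∣_∣ (ℤₚ.[+m]-[+n]≡m⊖n a b)))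
    (≤-<-trans (ℤₚ.∣m⊝n∣≤m⊔n a b) (⊔-pres-<m a<r b<r))

divMod-unique : ∀ r .{{_ : NonZero r}} z ρ q → ρ < r → z ≡ + ρ ℤ.+ q ℤ.* + r → z ℤᵈ./ℕ r ≡ q × z ℤᵈ.%ℕ r ≡ ρ
divMod-unique r z ρ q ρ<r e = q≡ , ℤₚ.+-injective (trans (cancel (+ ρ′) (q ℤ.* + r))
    (trans (cong (ℤ._- (q ℤ.* + r)) (trans (cong (λ q → + ρ′ ℤ.+ q ℤ.* + r) (sym q≡)) e′)) (sym (cancel (+ ρ) (q ℤ.* + r)))))
  where
  cancel : ∀ a b → a ≡ a ℤ.+ b ℤ.- b
  cancel = ℤˢ.solve-∀
  ρ′ : ℕ
  ρ′ = z ℤᵈ.%ℕ r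
  q′ : ℤ
  q′ = z ℤᵈ./ℕ r
  e′ : + ρ′ ℤ.+ q′ ℤ.* + r ≡ + ρ ℤ.+ q ℤ.* + r
  e′ = trans (sym (ℤᵈ.a≡a%ℕn+[a/ℕn]*n z r)) e
  diff : (q′ ℤ.- q) ℤ.* + r ≡ + ρ ℤ.- + ρ′
  diff = trans (lem₁ q′ q (+ r) (+ ρ′)) (trans (cong (λ z → z ℤ.- + ρ′ ℤ.- q ℤ.* + r) e′) (lem₂ (+ ρ) (+ ρ′) (q ℤ.* + r)))
    where
    lem₁ : ∀ q′ q r ρ′ → (q′ ℤ.- q) ℤ.* r ≡ ρ′ ℤ.+ q′ ℤ.* r ℤ.- ρ′ ℤ.- q ℤ.* r
    lem₁ = ℤˢ.solve-∀
    lem₂ : ∀ ρ ρ′ qr → ρ ℤ.+ qr ℤ.- ρ′ ℤ.- qr ≡ ρ ℤ.- ρ′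
    lem₂ = ℤˢ.solve-∀
  small : ∣ q′ ℤ.- q ∣ * r < 1 * r
  small = ≤-<-trans (≤-reflexive (trans (sym (ℤₚ.abs-* (q′ ℤ.- q) (+ r))) (cong ∣_∣ diff)))
    (<-≤-trans (abs-diff-< ρ ρ′ r ρ<r (ℤᵈ.n%ℕd<d z r)) (≤-reflexive (sym (*-identityˡ r))))
  q≡ : q′ ≡ q
  q≡ = ℤₚ.i-j≡0⇒i≡j q′ q (ℤₚ.∣i∣≡0⇒i≡0 (n<1⇒n≡0 (*-cancelʳ-< r _ 1 small)))

bound : ∀ {k} → Vec ℤ k → ℕ
bound []       = 0
bound (v ∷ vs) = ∣ v ∣ ⊔ bound vs

map-cong-bound : ∀ {k} {B : Set} {f g : ℤ → B} (vs : Vec ℤ k) → (∀ v → ∣ v ∣ ≤ bound vs → f v ≡ g v) →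
    Vec.map f vs ≡ Vec.map g vs
map-cong-bound []       e = refl
map-cong-bound (v ∷ vs) e = cong₂ _∷_ (e v (m≤m⊔n ∣ v ∣ (bound vs)))
  (map-cong-bound vs λ u u≤ → e u (≤-trans u≤ (m≤n⊔m ∣ v ∣ (bound vs))))

global-cong : ∀ A (c d : Config (states A)) z z′ → (∀ v → ∣ v ∣ ≤ bound (nbhd A) → c (z ℤ.+ v) ≡ d (z′ ℤ.+ v)) →
  global A c z ≡ global A d z′
global-cong A c d z z′ e = cong (rule A) (map-cong-bound (nbhd A) e)

iter-+ : ∀ A m n x → iter A (m + n) x ≡ iter A m (iter A n x)
iter-+ A zero    n x = refl
iter-+ A (suc m) n x = cong (global A) (iter-+ A m n x)

funToFin-cong : ∀ {m n} {f g : Fin m → Fin n} → f ≗ g → funToFin f ≡ funToFin g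
funToFin-cong {zero}  e = refl
funToFin-cong {suc m} e = cong₂ combine (e zero) (funToFin-cong (e ∘ suc))

-- The automaton U and its arrays of blocks

U : CA
U = record
  { states = size cell-finite ; k = 3 ; nbhd = ℤ.-1ℤ ∷ ℤ.0ℤ ∷ ℤ.1ℤ ∷ []
  ; rule = λ { (l ∷ c ∷ r ∷ []) → to cell-finite (step (from cell-finite l) (from cell-finite c) (from cell-finite r)) } }

cells : Config (states U) → ℤ → Cell
cells x z = from cell-finite (x z)

U-persistent : Persistent U
U-persistent = to cell-finite dead , λ c i e → cong (to cell-finite)
    (cong (λ s → step (cells c (i ℤ.+ ℤ.-1ℤ)) s (cells c (i ℤ.+ ℤ.1ℤ)))
  (trans (cong (cells c) (ℤₚ.+-identityʳ i)) (trans (cong (from cell-finite) e) (from-to cell-finite dead))))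

cells-step : ∀ x z → cells (global U x) z ≡ step (cells x (z ℤ.+ ℤ.-1ℤ)) (cells x z) (cells x (z ℤ.+ ℤ.1ℤ))
cells-step x z = trans (from-to cell-finite _)
  (cong (λ s → step (cells x (z ℤ.+ ℤ.-1ℤ)) s (cells x (z ℤ.+ ℤ.1ℤ))) (cong (cells x) (ℤₚ.+-identityʳ z)))

module Blocks (prog : List Op) (ordinary : Ordinary prog) where

  os : List Op
  os = init ∷ nop ∷ nop ∷ prog

  W h w T : ℕ
  W = length os
  h = W + W
  w = suc h
  T = W * (w + w)

  isBlock : ∀ x z → Dec (Good h (clock h) (schedule h os) 0 (rowRight x z))
  isBlock x z = good? h (clock h) (schedule h os) 0 (rowRight x z)

  blocks : (ℤ → Cell) → ℤ → Message
  blocks x i = content (does (isBlock x (i ℤ.* + w))) (regsOf (x (i ℤ.* + w)))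

  blocks-cong : ∀ x x′ i i′ → (∀ y → y ≤ w → x (i ℤ.* + w ℤ.+ + y) ≡ x′ (i′ ℤ.* + w ℤ.+ + y)) → blocks x i ≡ blocks x′ i′
  blocks-cong x x′ i i′ e = cong₂ content same
      (cong regsOf (trans (cong x (sym (ℤₚ.+-identityʳ _))) (trans (e 0 z≤n) (cong x′ (ℤₚ.+-identityʳ _)))))
    where
    same : does (isBlock x (i ℤ.* + w)) ≡ does (isBlock x′ (i′ ℤ.* + w))
    same with isBlock x (i ℤ.* + w) | isBlock x′ (i′ ℤ.* + w)
    ... | yes _ | yes _ = refl
    ... | no _  | no _  = refl
    ... | yes G | no ¬G = ⊥-elim (¬G (good-cong (λ y y≤ → cong shape (e y y≤)) G))
    ... | no ¬G | yes G = ⊥-elim (¬G (good-cong (λ y y≤ → cong shape (sym (e y y≤))) G))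

  blocks-step : ∀ {m} (ds : Vec Offset m) g → prog ≡ compile ds g → ∀ x i →
    blocks (cells (iter U T x)) i ≡ applied ds g (blocks (cells x)) i
  blocks-step ds g refl x i = trans (simulates i)
      (Parallel.compiled valid (blocks (cells x)) ds g {λ i → regs 0 (position i)} (λ _ → refl) i)
    where
    open Simulation (λ t → cells (iter U t x)) (λ t z → cells-step (iter U t x) z) prog ordinary

  token : Kind → Token
  token ∅ = empty
  token ● = ping nothing
  token ○ = pong

  kind-token : ∀ κ → kind (token κ) ≡ κ
  kind-token ∅ = refl
  kind-token ● = refl
  kind-token ○ = refl

  symbol : Message → Reg
  symbol m = ⟨ Maybe.maybe proj₁ false m , Maybe.maybe proj₂ false m , false , false , nothing ⟩

  -- This is the content that `Good` prescribes at time 0. A marker lies in two blocks: its first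
  -- token is outgoing at the near end of the right block, its second is incoming at the far end of
  -- the left one.
  build : (ℤ → Message) → ℤ → ℕ → Cell
  build y i zero    = mk (token (clock h (h + w))) (token (clock h h)) false nothing (symbol (y i))
  build y i (suc u) = mid (token (clock h (h ∸ suc u + w))) (token (clock h u)) (schedule h os (h ∸ suc u)) (schedule h os u)

  buildAll : (ℤ → Message) → ℤ → Cell
  buildAll y z = build y (z ℤᵈ./ℕ w) (z ℤᵈ.%ℕ w)

  buildAll-at : ∀ y i ρ → ρ < w → buildAll y (i ℤ.* + w ℤ.+ + ρ) ≡ build y i ρ
  buildAll-at y i ρ ρ<w = cong₂ (build y) (proj₁ D) (proj₂ D)
    where D = divMod-unique w (i ℤ.* + w ℤ.+ + ρ) ρ i ρ<w (ℤₚ.+-comm (i ℤ.* + w) (+ ρ))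

  build-good : ∀ y i → Good h (clock h) (schedule h os) 0 (rowRight (buildAll y) (i ℤ.* + w))
  build-good y i = record
    { intact = record { start = cong type (row 0 z<s) ; mids = λ u u<h → cong type
        (row (suc u) (s≤s u<h)) ; end = cong type row-w }
    ; inK≡  = in≡
    ; outK≡ = out≡
    ; inO≡  = λ u u<h → cong inO (row (suc u) (s≤s u<h))
    ; outO≡ = λ u u′ e → trans (cong outO (row (suc u) (s≤s (≤-trans (s≤s (m≤m+n u u′)) (≤-reflexive e)))))
        (cong (schedule h os) (rest u u′ e)) }
    where
    row : ∀ ρ → ρ < w → rowRight (buildAll y) (i ℤ.* + w) ρ ≡ shape (build y i ρ)
    row ρ ρ<w = cong shape (buildAll-at y i ρ ρ<w)
    row-w : rowRight (buildAll y) (i ℤ.* + w) w ≡ shape (build y (i ℤ.+ ℤ.1ℤ) 0)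
    row-w = trans (cong (shape ∘ buildAll y) (lem i (+ w))) (cong shape (buildAll-at y (i ℤ.+ ℤ.1ℤ) 0 z<s))
      where
      lem : ∀ i w → i ℤ.* w ℤ.+ w ≡ (i ℤ.+ ℤ.1ℤ) ℤ.* w ℤ.+ ℤ.0ℤ
      lem = ℤˢ.solve-∀
    rest : ∀ u u′ → suc (u + u′) ≡ h → h ∸ suc u ≡ u′
    rest u u′ e = trans (cong (_∸ suc u) (sym e)) (m+n∸m≡n u u′)
    in≡ : ∀ u → u ≤ h → inK (rowRight (buildAll y) (i ℤ.* + w) (suc u)) ≡ clock h u
    in≡ u u≤h with m≤n⇒m<n∨m≡n u≤h
    ... | inj₁ u<h  = trans (cong inK (row (suc u) (s≤s u<h))) (kind-token _)
    ... | inj₂ refl = trans (cong inK row-w) (kind-token _)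
    out≡ : ∀ a b → a + b ≡ h → outK (rowRight (buildAll y) (i ℤ.* + w) a) ≡ clock h (b + w)
    out≡ zero    b refl = trans (cong outK (row 0 z<s)) (kind-token _)
    out≡ (suc u) b e    = trans (cong outK (row (suc u) (s≤s (≤-trans (s≤s (m≤m+n u b)) (≤-reflexive e)))))
      (trans (kind-token _) (cong (λ n → clock h (n + w)) (rest u b e)))

  blocks-build : ∀ y → (∀ i → ∃ λ s → y i ≡ just s) → ∀ i → blocks (buildAll y) i ≡ y i
  blocks-build y J i = trans (cong₂ content (dec-true (isBlock (buildAll y) (i ℤ.* + w)) (build-good y i))
      (cong regsOf (trans (cong (buildAll y) (sym (ℤₚ.+-identityʳ (i ℤ.* + w)))) (buildAll-at y i 0 z<s))))
    (trans (cong (content true ∘ symbol) (proj₂ (J i))) (sym (proj₂ (J i))))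

-- Simulation of an arbitrary persistent automaton

module Realize (A : CA) (q₀ : Fin (states A)) (persistent : ∀ c i → c i ≡ q₀ → global A c i ≡ q₀) where

  Q r n : ℕ
  Q = states A
  r = suc (bound (nbhd A))
  n = Q ^ r

  v₀ : Fin n
  v₀ = funToFin (λ (_ : Fin r) → q₀)

  unblock : (ℤ → Fin n) → Config Q
  unblock Y z = finToFun {Q} {r} (Y (z ℤᵈ./ℕ r)) (fromℕ< (ℤᵈ.n%ℕd<d z r))

  unblock-at : ∀ Y z q (ρ : Fin r) → z ≡ + toℕ ρ ℤ.+ q ℤ.* + r → unblock Y z ≡ finToFun {Q} {r} (Y q) ρ
  unblock-at Y z q ρ e = cong₂ (λ q → finToFun {Q} {r} (Y q)) (proj₁ D)
    (trans (Finₚ.fromℕ<-cong _ _ (proj₂ D) _ (toℕ<n ρ)) (fromℕ<-toℕ ρ _))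
    where D = divMod-unique r z (toℕ ρ) q (toℕ<n ρ) e

  euclid : ∀ z → z ≡ + toℕ (fromℕ< (ℤᵈ.n%ℕd<d z r)) ℤ.+ (z ℤᵈ./ℕ r) ℤ.* + r
  euclid z = trans (ℤᵈ.a≡a%ℕn+[a/ℕn]*n z r) (cong (λ ρ → + ρ ℤ.+ (z ℤᵈ./ℕ r) ℤ.* + r) (sym (toℕ-fromℕ< _)))

  unblock-shift : ∀ Y z i → unblock Y (z ℤ.+ i ℤ.* + r) ≡ unblock (λ I → Y (I ℤ.+ i)) z
  unblock-shift Y z i = unblock-at Y (z ℤ.+ i ℤ.* + r) (z ℤᵈ./ℕ r ℤ.+ i) (fromℕ< (ℤᵈ.n%ℕd<d z r))
    (trans (cong (ℤ._+ i ℤ.* + r) (euclid z)) (lem (+ toℕ (fromℕ< (ℤᵈ.n%ℕd<d z r))) (z ℤᵈ./ℕ r) i (+ r)))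
    where
    lem : ∀ ρ q i r → ρ ℤ.+ q ℤ.* r ℤ.+ i ℤ.* r ≡ ρ ℤ.+ (q ℤ.+ i) ℤ.* r
    lem = ℤˢ.solve-∀

  nearby : Fin n → Fin n → Fin n → ℤ → Fin n
  nearby l c r -[1+ _ ]  = l
  nearby l c r (+ zero)  = c
  nearby l c r (+ suc _) = r

  -- One step of A on the middle of three consecutive r-tuples of cells.
  f : Fin n → Fin n → Fin n → Fin n
  f l c r′ = funToFin {r} {Q} (λ ρ → global A (unblock (nearby l c r′)) (+ toℕ ρ))

  f-persistent : ∀ l r′ → f l v₀ r′ ≡ v₀
  f-persistent l r′ = funToFin-cong {r} {Q} (λ ρ → persistent (unblock (nearby l v₀ r′)) (+ toℕ ρ)
    (trans (unblock-at (nearby l v₀ r′) (+ toℕ ρ) ℤ.0ℤ ρ (sym (ℤₚ.+-identityʳ _))) (finToFun-funToFin (λ _ → q₀) ρ)))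

  nearby≡ : ∀ (Y : ℤ → Fin n) I q → ∣ q ∣ < 2 → nearby (Y (I ℤ.+ ℤ.-1ℤ)) (Y I) (Y (I ℤ.+ ℤ.1ℤ)) q ≡ Y (q ℤ.+ I)
  nearby≡ Y I -[1+ zero ]        _ = cong Y (ℤₚ.+-comm I ℤ.-1ℤ)
  nearby≡ Y I (+ zero)           _ = cong Y (sym (ℤₚ.+-identityˡ I))
  nearby≡ Y I (+ suc zero)       _ = cong Y (ℤₚ.+-comm I ℤ.1ℤ)
  nearby≡ Y I -[1+ suc _ ]       (s≤s (s≤s ()))
  nearby≡ Y I (+ suc (suc _))    (s≤s (s≤s ()))

  -- Since `r` exceeds the radius of `A`, a neighbour of a cell in the middle tuple lies in that
  -- tuple or an adjacent one.
  div-small : ∀ (ρ : Fin r) v → ∣ v ∣ ≤ bound (nbhd A) → ∣ (+ toℕ ρ ℤ.+ v) ℤᵈ./ℕ r ∣ < 2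
  div-small ρ v v≤ = *-cancelʳ-< r _ 2 (≤-<-trans (≤-reflexive (trans (sym (ℤₚ.abs-* q (+ r))) (cong ∣_∣ diff)))
    (≤-<-trans (ℤₚ.∣i+j∣≤∣i∣+∣j∣ v _) (<-≤-trans
        (+-mono-≤-< (≤-trans v≤ (n≤1+n _)) (abs-diff-< _ _ r (toℕ<n ρ) (ℤᵈ.n%ℕd<d z r)))
      (≤-reflexive (cong (λ s → r + s) (sym (+-identityʳ r)))))))
    where
    z q : ℤ
    z = + toℕ ρ ℤ.+ v
    q = z ℤᵈ./ℕ r
    diff : q ℤ.* + r ≡ v ℤ.+ (+ toℕ ρ ℤ.- + (z ℤᵈ.%ℕ r))
    diff = trans (lem₁ (q ℤ.* + r) (+ (z ℤᵈ.%ℕ r)))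
        (trans (cong (ℤ._- + (z ℤᵈ.%ℕ r)) (sym (ℤᵈ.a≡a%ℕn+[a/ℕn]*n z r))) (lem₂ (+ toℕ ρ) v _))
      where
      lem₁ : ∀ a b → a ≡ b ℤ.+ a ℤ.- b
      lem₁ = ℤˢ.solve-∀
      lem₂ : ∀ a v b → a ℤ.+ v ℤ.- b ≡ v ℤ.+ (a ℤ.- b)
      lem₂ = ℤˢ.solve-∀

  unblock-step : ∀ Y z → unblock (λ I → f (Y (I ℤ.+ ℤ.-1ℤ)) (Y I) (Y (I ℤ.+ ℤ.1ℤ))) z ≡ global A (unblock Y) z
  unblock-step Y z = trans (finToFun-funToFin {r} {Q} (λ ρ → global A near (+ toℕ ρ)) ρ)
      (global-cong A near (unblock Y) (+ toℕ ρ) z λ v v≤ → trans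
    (cong (λ q → finToFun {Q} {r} q (fromℕ< (ℤᵈ.n%ℕd<d (+ toℕ ρ ℤ.+ v) r)))
        (nearby≡ Y I ((+ toℕ ρ ℤ.+ v) ℤᵈ./ℕ r) (div-small ρ v v≤)))
    (trans (sym (unblock-shift Y (+ toℕ ρ ℤ.+ v) I))
        (cong (unblock Y) (trans (lem (+ toℕ ρ) v (I ℤ.* + r)) (cong (ℤ._+ v) (sym (euclid z)))))))
    where
    ρ : Fin r
    ρ = fromℕ< (ℤᵈ.n%ℕd<d z r)
    I : ℤ
    I = z ℤᵈ./ℕ r
    near : Config Q
    near = unblock (nearby (Y (I ℤ.+ ℤ.-1ℤ)) (Y I) (Y (I ℤ.+ ℤ.1ℤ)))
    lem : ∀ ρ v I → ρ ℤ.+ v ℤ.+ I ≡ ρ ℤ.+ I ℤ.+ v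
    lem = ℤˢ.solve-∀

  open Group v₀

  prog : List Op
  prog = compile offsets (newBit f)

  open Blocks prog (ordinary-compile offsets (newBit f))

  -- The value of group I; the group to its left starts at block (I - 1) n.
  value : (ℤ → Message) → ℤ → Fin n
  value M I = decode (block M ((I ℤ.+ ℤ.-1ℤ) ℤ.* + n) own)

  decode-≗ : ∀ {G H} → (∀ q → G q ≡ H q) → decode G ≡ decode H
  decode-≗ e = decode-cong (λ q eq → trans (sym (e q)) eq) (λ _ → e)

  member : ℤ → Fin n → ℤ
  member I q = (I ℤ.+ ℤ.-1ℤ) ℤ.* + n ℤ.+ + (1 * n + toℕ q)

  value-cong : ∀ (M M′ : ℤ → Message) I I′ → (∀ q → M (member I q) ≡ M′ (member I′ q)) →
    value M I ≡ value M′ I′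
  value-cong M M′ I I′ e = decode-≗ e

  value-step : ∀ M I → value (applied offsets (newBit f) M) I ≡ f (value M (I ℤ.+ ℤ.-1ℤ)) (value M I) (value M (I ℤ.+ ℤ.1ℤ))
  value-step M I = trans (group-step f f-persistent M ((I ℤ.+ ℤ.-1ℤ) ℤ.* + n))
    (cong₂ (λ a b → f a (value M I) b) (decode-≗ λ q → cong M (left≡ I (+ n) (+ toℕ q)))
        (decode-≗ λ q → cong M (right≡ I (+ n) (+ toℕ q))))
    where
    left≡ : ∀ I n q → (I ℤ.+ ℤ.-1ℤ) ℤ.* n ℤ.+ (ℤ.0ℤ ℤ.+ q) ≡ (I ℤ.+ ℤ.-1ℤ ℤ.+ ℤ.-1ℤ) ℤ.* n ℤ.+ ((n ℤ.+ ℤ.0ℤ) ℤ.+ q)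
    left≡ = ℤˢ.solve-∀
    right≡ : ∀ I n q → (I ℤ.+ ℤ.-1ℤ) ℤ.* n ℤ.+ ((n ℤ.+ (n ℤ.+ ℤ.0ℤ)) ℤ.+ q) ≡ (I ℤ.+ ℤ.1ℤ ℤ.+ ℤ.-1ℤ) ℤ.* n ℤ.+
        ((n ℤ.+ ℤ.0ℤ) ℤ.+ q)
    right≡ = ℤˢ.solve-∀

  unblock-cong : ∀ (Y Y′ : ℤ → Fin n) z → Y (z ℤᵈ./ℕ r) ≡ Y′ (z ℤᵈ./ℕ r) → unblock Y z ≡ unblock Y′ z
  unblock-cong Y Y′ z e = cong (λ v → finToFun {Q} {r} v (fromℕ< (ℤᵈ.n%ℕd<d z r))) e

  π : Config (states U) → Config Q
  π x = unblock (value (blocks (cells x)))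

  π-step : ∀ x → π (iter U T x) ≈ global A (π x)
  π-step x z = trans (unblock-cong (value M′) (λ I → f (Y (I ℤ.+ ℤ.-1ℤ)) (Y I) (Y (I ℤ.+ ℤ.1ℤ))) z
      (trans (value-cong M′ (applied offsets (newBit f) M) I I (λ q → blocks-step offsets (newBit f) refl x (member I q)))
        (value-step M I)))
    (unblock-step Y z)
    where
    I : ℤ
    I = z ℤᵈ./ℕ r
    M M′ : ℤ → Message
    M  = blocks (cells x)
    M′ = blocks (cells (iter U T x))
    Y : ℤ → Fin n
    Y = value M

  π-iter : ∀ a x → π (iter U (T * a) x) ≈ iter A (1 * a) (π x)
  π-iter zero    x z = cong (λ t → π (iter U t x) z) (*-zeroʳ T)
  π-iter (suc a) x z = trans (cong (λ u → π u z) (trans (cong (λ t → iter U t x) (*-suc T a)) (iter-+ U T (T * a) x)))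
    (trans (π-step (iter U (T * a) x) z) (global-cong A (π (iter U (T * a) x)) (iter A (1 * a) (π x)) z z λ v _ →
        π-iter a x (z ℤ.+ v)))

  π-shift : ∀ b x → π (σ (+ (w * n) ℤ.* b) x) ≈ σ (+ r ℤ.* b) (π x)
  π-shift b x z = trans (unblock-cong (value (blocks (cells x′))) (λ I → value (blocks (cells x)) (I ℤ.+ b)) z
      (value-cong (blocks (cells x′)) (blocks (cells x)) I (I ℤ.+ b) λ q →
      blocks-cong (cells x′) (cells x) (member I q) (member (I ℤ.+ b) q) λ y _ → cong (cells x) (place (+ toℕ q) (+ y))))
    (trans (sym (unblock-shift (value (blocks (cells x))) z b)) (cong (λ i → π x (z ℤ.+ i)) (ℤₚ.*-comm b (+ r))))
    where
    x′ : Config (states U)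
    x′ = σ (+ (w * n) ℤ.* b) x
    I : ℤ
    I = z ℤᵈ./ℕ r
    lem : ∀ I b n w q y → ((I ℤ.+ ℤ.-1ℤ) ℤ.* n ℤ.+ ((n ℤ.+ ℤ.0ℤ) ℤ.+ q)) ℤ.* w ℤ.+ y ℤ.+ w ℤ.* n ℤ.* b
      ≡ ((I ℤ.+ b ℤ.+ ℤ.-1ℤ) ℤ.* n ℤ.+ ((n ℤ.+ ℤ.0ℤ) ℤ.+ q)) ℤ.* w ℤ.+ y
    lem = ℤˢ.solve-∀
    place : ∀ q y → ((I ℤ.+ ℤ.-1ℤ) ℤ.* + n ℤ.+ ((+ n ℤ.+ ℤ.0ℤ) ℤ.+ q)) ℤ.* + w ℤ.+ y ℤ.+ + (w * n) ℤ.* b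
      ≡ ((I ℤ.+ b ℤ.+ ℤ.-1ℤ) ℤ.* + n ℤ.+ ((+ n ℤ.+ ℤ.0ℤ) ℤ.+ q)) ℤ.* + w ℤ.+ y
    place q y = trans (cong (λ wn → ((I ℤ.+ ℤ.-1ℤ) ℤ.* + n ℤ.+ ((+ n ℤ.+ ℤ.0ℤ) ℤ.+ q)) ℤ.* + w ℤ.+ y ℤ.+ wn ℤ.* b)
        (ℤₚ.pos-* w n))
      (lem I b (+ n) (+ w) q y)

  π-equivariant : ∀ a b x → π (scaled U T (w * n) a b x) ≈ scaled A 1 r a b (π x)
  π-equivariant a b x z = trans (π-shift b (iter U (T * a) x) z) (π-iter a x (z ℤ.+ + r ℤ.* b))

  abs-linear : ∀ i m j → ∣ i ℤ.* + m ℤ.+ + j ∣ ≤ ∣ i ∣ * m + j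
  abs-linear i m j = ≤-trans (ℤₚ.∣i+j∣≤∣i∣+∣j∣ (i ℤ.* + m) (+ j)) (≤-reflexive (cong (_+ j) (ℤₚ.abs-* i (+ m))))

  abs-div : ∀ z → ∣ z ℤᵈ./ℕ r ∣ ≤ ∣ z ∣ + r
  abs-div z = ≤-trans (m≤m*n ∣ q ∣ r) (≤-trans (≤-reflexive (trans (sym (ℤₚ.abs-* q (+ r))) (cong ∣_∣ diff)))
    (≤-trans (ℤₚ.∣i-j∣≤∣i∣+∣j∣ z (+ (z ℤᵈ.%ℕ r))) (+-monoʳ-≤ ∣ z ∣ (<⇒≤ (ℤᵈ.n%ℕd<d z r)))))
    where
    q : ℤ
    q = z ℤᵈ./ℕ r
    diff : q ℤ.* + r ≡ z ℤ.- + (z ℤᵈ.%ℕ r)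
    diff = trans (lem (q ℤ.* + r) (+ (z ℤᵈ.%ℕ r))) (cong (ℤ._- + (z ℤᵈ.%ℕ r)) (sym (ℤᵈ.a≡a%ℕn+[a/ℕn]*n z r)))
      where
      lem : ∀ a b → a ≡ b ℤ.+ a ℤ.- b
      lem = ℤˢ.solve-∀

  π-continuous : Continuous π
  π-continuous x R = s , λ y e j j≤R → unblock-cong (value (blocks (cells x))) (value (blocks (cells y))) j
      (value-cong (blocks (cells x)) (blocks (cells y)) (j ℤᵈ./ℕ r) (j ℤᵈ./ℕ r) λ q →
      blocks-cong (cells x) (cells y) (member (j ℤᵈ./ℕ r) q) (member (j ℤᵈ./ℕ r) q) λ u u≤w → cong
          (from cell-finite) (e _ (near j j≤R q u u≤w)))
    where
    s : ℕ
    -- Here `R + r + 1` bounds the index of the preceding group; the factor `n` converts groups to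
    -- blocks, the factor `w` blocks to cells, and the last `w` covers the cells of the block
    -- itself.
    s = ((R + r + 1) * n + (1 * n + n)) * w + w
    near : ∀ j → ∣ j ∣ ≤ R → ∀ (q : Fin n) u → u ≤ w →
      ∣ member (j ℤᵈ./ℕ r) q ℤ.* + w ℤ.+ + u ∣ ≤ s
    near j j≤R q u u≤w = ≤-trans (abs-linear (member (j ℤᵈ./ℕ r) q) w u) (+-mono-≤ (*-monoˡ-≤ w
      (≤-trans (abs-linear B n (1 * n + toℕ q)) (+-mono-≤ (*-monoˡ-≤ n B≤) (+-monoʳ-≤ (1 * n) (<⇒≤ (toℕ<n q)))))) u≤w)
      where
      B : ℤ
      B = j ℤᵈ./ℕ r ℤ.+ ℤ.-1ℤ
      B≤ : ∣ B ∣ ≤ R + r + 1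
      B≤ = ≤-trans (ℤₚ.∣i+j∣≤∣i∣+∣j∣ (j ℤᵈ./ℕ r) ℤ.-1ℤ) (+-monoˡ-≤ 1 (≤-trans (abs-div j) (+-monoˡ-≤ r j≤R)))

  n>0 : n > 0
  n>0 = ≤-<-trans z≤n (toℕ<n v₀)

  π-onto : Onto π
  π-onto y = x , λ z → trans (unblock-cong (value (blocks (cells x))) Y z (value-x (z ℤᵈ./ℕ r)))
      (trans (finToFun-funToFin (λ (ρ : Fin r) → y (+ toℕ ρ ℤ.+ (z ℤᵈ./ℕ r) ℤ.* + r)) _) (cong y (sym (euclid z))))
    where
    instance
      n≢0 : NonZero n
      n≢0 = >-nonZero n>0
    Y : ℤ → Fin n
    Y I = funToFin (λ (ρ : Fin r) → y (+ toℕ ρ ℤ.+ I ℤ.* + r))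
    -- In the preimage every block is valid, the first of each group is marked, and each group holds
    -- its tuple one-hot.
    M : ℤ → Message
    M p = just (isZero (p ℤᵈ.%ℕ n) , oneHot (Y (p ℤᵈ./ℕ n)) (fromℕ< (ℤᵈ.n%ℕd<d p n)))
    M-at : ∀ I (q : Fin n) → M (member I q) ≡ just (isZero (toℕ q) , oneHot (Y I) q)
    M-at I q = cong just (cong₂ _,_ (cong isZero (proj₂ D)) (cong₂ (λ J p → oneHot (Y J) p) (proj₁ D)
      (trans (Finₚ.fromℕ<-cong _ _ (proj₂ D) _ (toℕ<n q)) (fromℕ<-toℕ q _))))
      where
      lem : ∀ I n q → (I ℤ.+ ℤ.-1ℤ) ℤ.* n ℤ.+ ((n ℤ.+ ℤ.0ℤ) ℤ.+ q) ≡ q ℤ.+ I ℤ.* n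
      lem = ℤˢ.solve-∀
      D = divMod-unique n (member I q) (toℕ q) I (toℕ<n q) (lem I (+ n) (+ toℕ q))
    value-M : ∀ I → value M I ≡ Y I
    value-M I = trans (decode-≗ (M-at I)) (trans (decode-legal _ (λ q → refl)) (search-oneHot (Y I) id v₀))
    x : Config (states U)
    x z = to cell-finite (buildAll M z)
    blocks-x : ∀ p → blocks (cells x) p ≡ M p
    blocks-x p = trans (blocks-cong (cells x) (buildAll M) p p (λ u _ → from-to cell-finite _))
        (blocks-build M (λ _ → _ , refl) p)
    value-x : ∀ I → value (blocks (cells x)) I ≡ Y I
    value-x I = trans (value-cong (blocks (cells x)) M I I (λ q → blocks-x (member I q))) (value-M I)

  A≼U : A ≼ U
  -- A pass of `T` steps simulates one step of `A`, and a group of `w * n` cells stands for `r`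
  -- cells of `A`.
  A≼U = T , w * n , 1 , r , s≤s z≤n , *-mono-≤ {1} {w} {1} {n} (s≤s z≤n) n>0 , s≤s z≤n , s≤s z≤n ,
    π , π-continuous , π-onto , π-equivariant

theorem2 : Σ CA λ U → Persistent U × (∀ (A : CA) → Persistent A → A ≼ U)
theorem2 = U , U-persistent , λ A (q₀ , persistent) → Realize.A≼U A q₀ persistent
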